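{- For every integer $k\ge 0$, the neighborhood complex $\mathcal{N}(S_{3,k})$ collapses (by a finite sequence of elementary simplicial collapses) onto the neighborhood complex $\mathcal{N}(SG_{3,k})$.
   Context: For a positive integer $n$, $[n]=\{1,\dots,n\}$. Fix an integer $k\ge 0$; arithmetic on elements of $[k+6]$ is modulo $k+6$ with representatives in $[k+6]$. The Kneser graph $KG_{3,k}$ has as vertices the $3$-element subsets of $[k+6]$, two vertices being adjacent iff they are disjoint. A vertex $v$ is stable if there is no $t\in[k+6]$ with $\{t,t+1\}\subseteq v$ (addition mod $k+6$, so $\{k+6,1\}$ counts as such a pair), and unstable otherwise. $SG_{3,k}$ (the stable Kneser graph) is the induced subgraph of $KG_{3,k}$ on the stable vertices. $S_{3,k}$ is the graph with the same vertex set as $KG_{3,k}$ whose edges are those edges of $KG_{3,k}$ having at least one stable endpoint. For a graph $G$, the neighborhood complex $\mathcal{N}(G)$ is the simplicial complex whose vertices are the non-isolated vertices of $G$ and whose simplices are the nonempty sets of vertices having a common neighbor in $G$. An elementary collapse removes from a simplicial complex all simplices $\gamma$ with $\sigma\subseteq\gamma\subseteq\tau$, where $\sigma\subsetneq\tau$ and $\tau$ is the unique maximal simplex containing $\sigma$. -}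

module Defs where

open import Data.Nat using (ℕ; suc; _+_)
open import Data.Nat.DivMod using (_mod_)
open import Data.Fin using (Fin; toℕ)
open import Data.Fin.Subset using (Subset; _∈_; _∉_; ∣_∣)
open import Data.Product using (Σ; ∃; _×_; _,_; proj₁)
open import Data.Sum using (_⊎_)
open import Data.List using (List; []; map)
open import Data.List.Relation.Unary.All using (All)
open import Data.List.Relation.Binary.Subset.Propositional using (_⊆_)
open import Relation.Binary.PropositionalEquality using (_≡_; _≢_)
open import Relation.Nullary using (¬_)
open import Function.Bundles using (_⇔_)

-- Generic simplicial-complex notions.
-- A simplex on a vertex type V is a finite set of vertices, represented
-- by a list (read as the set of its members; all notions below depend
-- only on membership).  A complex is a predicate on simplices.

Complex : Set → Set₁
Complex V = List V → Set

_≅_ : {V : Set} → Complex V → Complex V → Set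
_≅_ {V} K L = (γ : List V) → K γ ⇔ L γ

_⊊_ : {V : Set} → List V → List V → Set
σ ⊊ τ = σ ⊆ τ × ¬ (τ ⊆ σ)

Maximal : {V : Set} → Complex V → List V → Set
Maximal {V} K τ = K τ × ((γ : List V) → K γ → τ ⊆ γ → γ ⊆ τ)

UniqueMaxContaining : {V : Set} → Complex V → List V → List V → Set
UniqueMaxContaining {V} K σ τ =
  σ ⊆ τ × Maximal K τ ×
  ((ρ : List V) → Maximal K ρ → σ ⊆ ρ → (ρ ⊆ τ × τ ⊆ ρ))

ElementaryCollapse : {V : Set} → Complex V → Complex V → Set
ElementaryCollapse {V} K L =
  Σ (List V) λ σ → Σ (List V) λ τ →
    K σ × σ ⊊ τ × UniqueMaxContaining K σ τ ×
    ((γ : List V) → L γ ⇔ (K γ × ¬ (σ ⊆ γ × γ ⊆ τ)))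

data Collapses {V : Set} : Complex V → Complex V → Set₁ where
  done : {K L : Complex V} → K ≅ L → Collapses K L
  step : {K K′ L : Complex V} → ElementaryCollapse K K′ → Collapses K′ L → Collapses K L

-- Neighborhood complex of a graph given by its adjacency relation E:
-- nonempty sets of vertices having a common neighbour.  (Its vertices are
-- automatically the non-isolated vertices.)
NeighborhoodComplex : {V : Set} → (V → V → Set) → Complex V
NeighborhoodComplex {V} E σ = σ ≢ [] × ∃ λ (w : V) → All (λ v → E v w) σ

-- Image of a complex under a map of vertices (used to regard a complex on
-- a subset of vertices as a complex on the ambient vertex type).
Image : {W V : Set} → (W → V) → Complex W → Complex V
Image {W} f K γ = Σ (List W) λ σ → K σ × γ ⊆ map f σ × map f σ ⊆ γ

-- Kneser graphs KG_{3,k} on the ground set [k+6] = Fin (6 + k)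
-- (element i : Fin (k+6) stands for i+1 ∈ [k+6]).

Vertex : ℕ → Set
Vertex k = Σ (Subset (6 + k)) λ s → ∣ s ∣ ≡ 3

next : {k : ℕ} → Fin (6 + k) → Fin (6 + k)
next {k} t = suc (toℕ t) mod (6 + k)

Stable : {k : ℕ} → Vertex k → Set
Stable {k} v = ¬ (∃ λ (t : Fin (6 + k)) → t ∈ proj₁ v × next t ∈ proj₁ v)

Disjoint : {k : ℕ} → Vertex k → Vertex k → Set
Disjoint {k} u v = (i : Fin (6 + k)) → i ∈ proj₁ u → i ∉ proj₁ v

KG : (k : ℕ) → Vertex k → Vertex k → Set
KG k u v = Disjoint u v

S : (k : ℕ) → Vertex k → Vertex k → Set
S k u v = KG k u v × (Stable u ⊎ Stable v)

StableVertex : ℕ → Set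
StableVertex k = Σ (Vertex k) Stable

SG : (k : ℕ) → StableVertex k → StableVertex k → Set
SG k u v = KG k (proj₁ u) (proj₁ v)

{-# OPTIONS --safe #-}
module Submission where

-- Let n = k + 6.  A set of simplices closed under toggling a vertex a can be collapsed away
-- whenever it is an upper set, and such sets may be split along any monotone condition.
--
-- Simplices with an unstable vertex u ∋ 0, 1, y (positions on the cycle, 2 ≤ y ≤ n − 2) have a stable
-- common neighbour w.  If j is the first position after y not covered by the simplex and j ≤ n − 3,
-- then w can avoid j + 1 as well (replace j + 1 by j), so {0, y, j + 1} can be toggled.  Otherwise let i
-- be the first uncovered position before y; if i ≥ 3, then {0, i − 1, y} can be toggled for the
-- same reason.  If neither applies, only 2, n − 2, n − 1 can be uncovered: no room for w.
--
-- Simplices of stable vertices without a stable common neighbour are sorted by their union V.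
-- Its complement contains no stable triple, so V consists of at most two arcs.  The covers of such a V by
-- stable triples are matched by toggling a triple a of endpoints of the arcs (for one arc: both endpoints and
-- the third point).  Where a is the only triple covering a nonempty E ⊆ a, the other triples cover
-- exactly V ∖ E, again at most two arcs, and induction applies.

open import Defs
open import Data.Bool.Properties using () renaming (_≟_ to _≟ᵇ_)
open import Data.Empty using (⊥-elim)
open import Data.Fin using (Fin; zero; suc; toℕ)
open import Data.Fin.Properties using (toℕ<n; toℕ-injective; toℕ-fromℕ<; any?; all?) renaming (_≟_ to _≟ᶠ_)
open import Data.Fin.Subset using (Subset; inside; outside; ∣_∣; Nonempty) renaming (_∈_ to _∈ˢ_; _∉_ to _∉ˢ_; ⊥ to ∅)
open import Data.Fin.Subset.Properties using (∉⊥; ∣⊥∣≡0; nonempty?; Empty-unique) renaming (_∈?_ to _∈ˢ?_)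
open import Data.List using (List; []; _∷_; _++_; map; filter; allFin)
open import Data.List.Membership.Propositional using (_∈_; _∉_; find; lose)
import Data.List.Membership.DecPropositional as DecMembership
open import Data.List.Membership.Propositional.Properties using (∈-++⁺ˡ; ∈-++⁺ʳ; ∈-map⁺; ∈-filter⁺; ∈-filter⁻; ∈-allFin)
open import Data.List.Relation.Binary.Subset.Propositional using (_⊆_)
open import Data.List.Relation.Binary.Subset.Propositional.Properties using (Any-resp-⊆; All-resp-⊇)
open import Data.List.Relation.Unary.All as All using (All; []; _∷_)
open import Data.List.Relation.Unary.All.Properties using (map⁺)
open import Data.List.Relation.Unary.Any as Any using (Any; here; there)
open import Data.Nat using (ℕ; zero; suc; _+_; _*_; _∸_; _/_; _%_; _≤_; _<_; z≤n; s≤s; _≟_; _≤?_; _<?_)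
open import Data.Nat.DivMod using (m%n<n; m<n⇒m%n≡m; m%n%n≡m%n; [m+n]%n≡m%n; m≡m%n+[m/n]*n; %-congˡ; %-distribˡ-+)
open import Data.Nat.Properties hiding (_≟_; _≤?_; _<?_)
open import Data.Product using (Σ; ∃; _×_; _,_; proj₁; proj₂)
open import Data.Sum as Sum using (_⊎_; inj₁; inj₂)
open import Data.Vec using ([]; _∷_; here; there; _[_]≔_)
open import Data.Vec.Properties using (lookup∘update; lookup∘update′; []=⇒lookup; lookup⇒[]=; ≡-dec)
open import Function.Base using (_∘_; case_of_)
open import Function.Bundles using (mk⇔; Equivalence)
open import Relation.Binary.Definitions using (DecidableEquality; tri<; tri≈; tri>)
open import Relation.Binary.PropositionalEquality using (_≡_; _≢_; ≢-sym; refl; sym; trans; cong; cong₂; subst; subst₂; module ≡-Reasoning)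
open import Relation.Nullary using (¬_; Dec; yes; no)
open import Relation.Nullary.Decidable using (_×-dec_; _→-dec_; ¬?; map′; decidable-stable)
open import Relation.Unary using (Decidable)


open Equivalence using (to; from)

-- Removing upper sets of simplices by collapses

module _ {V : Set} where

  infixl 7 _∖_ _∩_
  _∖_ _∩_ : Complex V → Complex V → Complex V
  (K ∖ M) γ = K γ × ¬ M γ
  (M ∩ P) γ = M γ × P γ

  ∁ : Complex V → Complex V
  ∁ P γ = ¬ P γ

  Monotone : Complex V → Set
  Monotone P = ∀ {γ δ} → γ ⊆ δ → P γ → P δ

  Extensional : Complex V → Set
  Extensional M = ∀ {γ δ} → γ ⊆ δ → δ ⊆ γ → M γ → M δ

  collapses-respˡ-≅ : {K K′ L : Complex V} → K ≅ K′ → Collapses K′ L → Collapses K L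
  collapses-respˡ-≅ K≅K′ (done K′≅L) =
    done λ γ → mk⇔ (to (K′≅L γ) ∘ to (K≅K′ γ)) (from (K≅K′ γ) ∘ from (K′≅L γ))
  collapses-respˡ-≅ K≅K′
    (step (σ , τ , Kσ , σ⊊τ , (σ⊆τ , (Kτ , τmax) , unique) , spec) K″↘L) =
    step (σ , τ , from (K≅K′ σ) Kσ , σ⊊τ
         , (σ⊆τ , (from (K≅K′ τ) Kτ , λ γ Kγ → τmax γ (to (K≅K′ γ) Kγ))
           , λ ρ (Kρ , ρmax) → unique ρ (to (K≅K′ ρ) Kρ , λ γ Kγ → ρmax γ (from (K≅K′ γ) Kγ)))
         , λ γ → mk⇔ (λ Lγ → let (Kγ , out) = to (spec γ) Lγ in from (K≅K′ γ) Kγ , out)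
                     (λ (Kγ , out) → from (spec γ) (to (K≅K′ γ) Kγ , out)))
         K″↘L

  -- In continuation form, so that removals compose without transitivity of Collapses.
  Removable : Complex V → Set₁
  Removable M = {K L : Complex V} → (∀ {γ} → M γ → K γ) →
    (∀ {γ δ} → γ ⊆ δ → M γ → K δ → M δ) →
    Collapses (K ∖ M) L → Collapses K L

  removable-resp-≅ : {M N : Complex V} → M ≅ N → Removable N → Removable M
  removable-resp-≅ M≅N rem M⊆K upper K∖M↘L =
    rem (λ {γ} → M⊆K ∘ from (M≅N γ))
        (λ {γ} {δ} γ⊆δ Nγ Kδ → to (M≅N δ) (upper γ⊆δ (from (M≅N γ) Nγ) Kδ))
        (collapses-respˡ-≅
          (λ γ → mk⇔ (λ (Kγ , ¬N) → Kγ , ¬N ∘ to (M≅N γ)) (λ (Kγ , ¬M) → Kγ , ¬M ∘ from (M≅N γ)))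
          K∖M↘L)

  removable-empty : {M : Complex V} → (∀ {γ} → ¬ M γ) → Removable M
  removable-empty empty _ _ =
    collapses-respˡ-≅ λ γ → mk⇔ (λ Kγ → Kγ , empty) proj₁

  -- Monotonicity makes `M ∩ P` an upper set wherever `M` is one, so this half can go first; once it
  -- is gone, the other half is an upper set of what remains.
  removable-split : {M P : Complex V} → Decidable P → Monotone P →
    Removable (M ∩ P) → Removable (M ∩ ∁ P) → Removable M
  removable-split P? mono rem₁ rem₂ M⊆K upper K∖M↘L =
    rem₁ (M⊆K ∘ proj₁)
         (λ γ⊆δ (Mγ , Pγ) Kδ → upper γ⊆δ Mγ Kδ , mono γ⊆δ Pγ)
         (rem₂ (λ (Mγ , ¬Pγ) → M⊆K Mγ , ¬Pγ ∘ proj₂)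
               (λ γ⊆δ (Mγ , _) (Kδ , ¬MP) → let Mδ = upper γ⊆δ Mγ Kδ in Mδ , λ Pδ → ¬MP (Mδ , Pδ))
               (collapses-respˡ-≅
                 (λ γ → mk⇔ (λ ((Kγ , ¬MP) , ¬M¬P) → Kγ , λ Mγ → ¬M¬P (Mγ , λ Pγ → ¬MP (Mγ , Pγ)))
                            (λ (Kγ , ¬M) → (Kγ , ¬M ∘ proj₁) , ¬M ∘ proj₁))
                 K∖M↘L))

  module _ {I : Set} (_≟_ : DecidableEquality I) {P : I → Complex V}
           (P? : ∀ i → Decidable (P i)) (mono : ∀ i → Monotone (P i)) where

    open DecMembership _≟_ using (_∈?_)

    Fibre : Complex V → List I → List I → Complex V
    Fibre M ins outs γ = M γ × All (λ i → P i γ) ins × All (λ i → ¬ P i γ) outs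

    removable-fibres-acc : {M : Complex V} (is ins outs : List I) →
      (∀ ins′ outs′ → (∀ {i} → i ∈ is ⊎ i ∈ ins ⊎ i ∈ outs → i ∈ ins′ ⊎ i ∈ outs′) →
         (∀ {i} → i ∈ ins′ ⊎ i ∈ outs′ → i ∈ is ⊎ i ∈ ins ⊎ i ∈ outs) →
         (∀ {i} → i ∈ ins′ → i ∉ outs′) → Removable (Fibre M ins′ outs′)) →
      Removable (Fibre M ins outs)
    -- Repetitions in the list can put one index on both sides; such a fibre is empty.
    removable-fibres-acc [] ins outs fibre with Any.any? (_∈? outs) ins
    ... | yes clash = removable-empty λ (_ , Pins , ¬Pouts) →
      let Pi , i∈outs = All.lookupAny Pins clash in All.lookup ¬Pouts i∈outs Pi
    ... | no disjoint =
      fibre ins outs (λ { (inj₂ i∈) → i∈ }) inj₂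
        λ i∈ins i∈outs → disjoint (Any.map (λ { refl → i∈outs }) i∈ins)
    removable-fibres-acc (i ∷ is) ins outs fibre =
      removable-split (P? i) (mono i)
        (removable-resp-≅
          (λ γ → mk⇔ (λ ((Mγ , Pins , ¬Pouts) , Pi) → Mγ , Pi ∷ Pins , ¬Pouts)
                     (λ { (Mγ , Pi ∷ Pins , ¬Pouts) → (Mγ , Pins , ¬Pouts) , Pi }))
          (removable-fibres-acc is (i ∷ ins) outs λ ins′ outs′ complete sound →
            fibre ins′ outs′
              (λ { (inj₁ (here eq)) → complete (inj₂ (inj₁ (here eq)))
                 ; (inj₁ (there i∈)) → complete (inj₁ i∈)
                 ; (inj₂ (inj₁ i∈)) → complete (inj₂ (inj₁ (there i∈)))
                 ; (inj₂ (inj₂ i∈)) → complete (inj₂ (inj₂ i∈)) })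
              (λ j∈ → case₁ (sound j∈))))
        (removable-resp-≅
          (λ γ → mk⇔ (λ ((Mγ , Pins , ¬Pouts) , ¬Pi) → Mγ , Pins , ¬Pi ∷ ¬Pouts)
                     (λ { (Mγ , Pins , ¬Pi ∷ ¬Pouts) → (Mγ , Pins , ¬Pouts) , ¬Pi }))
          (removable-fibres-acc is ins (i ∷ outs) λ ins′ outs′ complete sound →
            fibre ins′ outs′
              (λ { (inj₁ (here eq)) → complete (inj₂ (inj₂ (here eq)))
                 ; (inj₁ (there i∈)) → complete (inj₁ i∈)
                 ; (inj₂ (inj₁ i∈)) → complete (inj₂ (inj₁ i∈))
                 ; (inj₂ (inj₂ i∈)) → complete (inj₂ (inj₂ (there i∈))) })
              (λ j∈ → case₂ (sound j∈))))
      where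
      case₁ : ∀ {j} → j ∈ is ⊎ j ∈ i ∷ ins ⊎ j ∈ outs → j ∈ i ∷ is ⊎ j ∈ ins ⊎ j ∈ outs
      case₁ (inj₁ j∈) = inj₁ (there j∈)
      case₁ (inj₂ (inj₁ (here eq))) = inj₁ (here eq)
      case₁ (inj₂ (inj₁ (there j∈))) = inj₂ (inj₁ j∈)
      case₁ (inj₂ (inj₂ j∈)) = inj₂ (inj₂ j∈)
      case₂ : ∀ {j} → j ∈ is ⊎ j ∈ ins ⊎ j ∈ i ∷ outs → j ∈ i ∷ is ⊎ j ∈ ins ⊎ j ∈ outs
      case₂ (inj₁ j∈) = inj₁ (there j∈)
      case₂ (inj₂ (inj₁ j∈)) = inj₂ (inj₁ j∈)
      case₂ (inj₂ (inj₂ (here eq))) = inj₁ (here eq)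
      case₂ (inj₂ (inj₂ (there j∈))) = inj₂ (inj₂ j∈)

    -- Iterated splitting: in each fibre the truth value of every listed condition is fixed, so a
    -- removal may be designed for each combination separately.
    removable-fibres : {M : Complex V} (is : List I) →
      (∀ ins outs → (∀ {i} → i ∈ is → i ∈ ins ⊎ i ∈ outs) →
         (∀ {i} → i ∈ ins ⊎ i ∈ outs → i ∈ is) →
         (∀ {i} → i ∈ ins → i ∉ outs) → Removable (Fibre M ins outs)) →
      Removable M
    removable-fibres is fibre =
      removable-resp-≅ (λ γ → mk⇔ (λ Mγ → Mγ , [] , []) proj₁)
        (removable-fibres-acc is [] [] λ ins outs complete sound →
          fibre ins outs (complete ∘ inj₁)
            (λ i∈ → case (sound i∈)))
      where
      case : ∀ {i} → i ∈ is ⊎ i ∈ [] ⊎ i ∈ [] → i ∈ is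
      case (inj₁ i∈) = i∈
      case (inj₂ (inj₁ ()))
      case (inj₂ (inj₂ ()))

  -- Collapsing sets of simplices closed under toggling a vertex

  module _ (_≟_ : DecidableEquality V) (vs : List V) (vs-complete : ∀ v → v ∈ vs) where

    open DecMembership _≟_ using (_∈?_)

    -- Splitting on all vertices other than a leaves pieces that are empty or a single pair {ins, a ∷ ins}.
    removable-cone : {M : Complex V} (a : V) → Decidable M → Extensional M →
      (∀ {γ} → M γ → M (a ∷ γ)) → (∀ {γ} → M (a ∷ γ) → M γ) → Removable M
    removable-cone {M} a M? ext add drop =
      removable-fibres _≟_ {P = λ v γ → v ∈ γ} (λ v γ → v ∈? γ) (λ v γ⊆δ → γ⊆δ)
        (filter (λ v → ¬? (v ≟ a)) vs) pair
      where
      others = filter (λ v → ¬? (v ≟ a)) vs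

      pair : ∀ ins outs → (∀ {v} → v ∈ others → v ∈ ins ⊎ v ∈ outs) →
        (∀ {v} → v ∈ ins ⊎ v ∈ outs → v ∈ others) → (∀ {v} → v ∈ ins → v ∉ outs) →
        Removable (λ γ → M γ × All (_∈ γ) ins × All (_∉ γ) outs)
      pair ins outs complete sound disjoint = result (M? (a ∷ ins))
        where
        a∉others : a ∉ others
        a∉others a∈ = proj₂ (∈-filter⁻ (λ v → ¬? (v ≟ a)) {xs = vs} a∈) refl

        below : ∀ {γ} → All (_∈ γ) ins → ins ⊆ γ
        below all = All.lookup all

        above : ∀ {γ} → All (_∉ γ) outs → γ ⊆ a ∷ ins
        above all {v} v∈γ with v ≟ a
        ... | yes v≡a = here v≡a
        ... | no v≢a with complete (∈-filter⁺ (λ v → ¬? (v ≟ a)) (vs-complete v) v≢a)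
        ...   | inj₁ v∈ins = there v∈ins
        ...   | inj₂ v∈outs = ⊥-elim (All.lookup all v∈outs v∈γ)

        a∷-⊆ : ∀ {γ} → ins ⊆ γ → a ∷ ins ⊆ a ∷ γ
        a∷-⊆ ins⊆γ (here eq) = here eq
        a∷-⊆ ins⊆γ (there v∈) = there (ins⊆γ v∈)

        ⊆-a∷ : ∀ {γ} → γ ⊆ a ∷ ins → a ∷ γ ⊆ a ∷ ins
        ⊆-a∷ γ⊆ (here eq) = here eq
        ⊆-a∷ γ⊆ (there v∈) = γ⊆ v∈

        M-between : M (a ∷ ins) → ∀ {γ} → ins ⊆ γ → γ ⊆ a ∷ ins → M γ
        M-between Ma∷ins ins⊆γ γ⊆ = drop (ext (a∷-⊆ ins⊆γ) (⊆-a∷ γ⊆) Ma∷ins)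

        avoids : ∀ {γ} → γ ⊆ a ∷ ins → All (_∉ γ) outs
        avoids γ⊆ = All.tabulate λ v∈outs v∈γ → case v∈outs (γ⊆ v∈γ)
          where
          case : ∀ {v} → v ∈ outs → v ∉ a ∷ ins
          case v∈outs (here refl) = a∉others (sound (inj₂ v∈outs))
          case v∈outs (there v∈ins) = disjoint v∈ins v∈outs

        result : Dec (M (a ∷ ins)) → Removable (λ γ → M γ × All (_∈ γ) ins × All (_∉ γ) outs)
        -- Up to membership the fibre could contain only `ins` and `a ∷ ins`, and `M` contains both
        -- or neither.
        result (no ¬M) = removable-empty λ (Mγ , in-γ , out-γ) →
          ¬M (ext (⊆-a∷ (above out-γ)) (a∷-⊆ (below in-γ)) (add Mγ))
        result (yes Ma∷ins) {K} N⊆K upper K∖N↘L =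
          step (ins , a ∷ ins , N⊆K N-ins
               , (there , λ ⊆ins → a∉others (sound (inj₁ (⊆ins (here refl)))))
               , (there , (N⊆K N-top , top-maximal) , λ ρ ρmax ins⊆ρ → unique ρ ρmax ins⊆ρ)
               , λ γ → mk⇔
                   (λ (Kγ , ¬N) → Kγ , λ (ins⊆γ , γ⊆) → ¬N (N-between ins⊆γ γ⊆))
                   (λ (Kγ , ¬between) → Kγ , λ (_ , in-γ , out-γ) → ¬between (below in-γ , above out-γ)))
               K∖N↘L
          where
          N : Complex V
          N γ = M γ × All (_∈ γ) ins × All (_∉ γ) outs
          N-between : ∀ {γ} → ins ⊆ γ → γ ⊆ a ∷ ins → N γ
          N-between ins⊆γ γ⊆ = M-between Ma∷ins ins⊆γ γ⊆ , All.tabulate ins⊆γ , avoids γ⊆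
          N-ins : N ins
          N-ins = N-between (λ v∈ → v∈) there
          N-top : N (a ∷ ins)
          N-top = N-between there (λ v∈ → v∈)
          -- Because `N` is an upper set of `K`, every face above `ins` is in `N` and hence below
          -- `a ∷ ins`; this makes `a ∷ ins` the unique maximal face there.
          contained : ∀ {γ} → K γ → ins ⊆ γ → γ ⊆ a ∷ ins
          contained Kγ ins⊆γ = above (proj₂ (proj₂ (upper ins⊆γ N-ins Kγ)))
          top-maximal : ∀ γ → K γ → a ∷ ins ⊆ γ → γ ⊆ a ∷ ins
          top-maximal γ Kγ top⊆γ = contained Kγ (top⊆γ ∘ there)
          unique : ∀ ρ → Maximal K ρ → ins ⊆ ρ → ρ ⊆ a ∷ ins × a ∷ ins ⊆ ρ
          unique ρ (Kρ , ρmax) ins⊆ρ =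
            contained Kρ ins⊆ρ , ρmax (a ∷ ins) (N⊆K N-top) (contained Kρ ins⊆ρ)

-- Subsets with one element added or deleted

∉-delete : ∀ {n} (p : Subset n) x → x ∉ˢ p [ x ]≔ outside
∉-delete p x x∈ with trans (sym ([]=⇒lookup x∈)) (lookup∘update x p outside)
... | ()

∈-update⁻ : ∀ {n} (p : Subset n) {x y b} → y ≢ x → y ∈ˢ p [ x ]≔ b → y ∈ˢ p
∈-update⁻ p {x} {y} {b} y≢x y∈ =
  lookup⇒[]= y p (trans (sym (lookup∘update′ y≢x p b)) ([]=⇒lookup y∈))

∣insert∣ : ∀ {n} (p : Subset n) {x} → x ∉ˢ p → ∣ p [ x ]≔ inside ∣ ≡ suc ∣ p ∣
∣insert∣ (inside ∷ p) {zero} x∉ = ⊥-elim (x∉ here)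
∣insert∣ (outside ∷ p) {zero} x∉ = refl
∣insert∣ (inside ∷ p) {suc x} x∉ = cong suc (∣insert∣ p (x∉ ∘ there))
∣insert∣ (outside ∷ p) {suc x} x∉ = ∣insert∣ p (x∉ ∘ there)

∣delete∣ : ∀ {n} (p : Subset n) {x} → x ∈ˢ p → suc ∣ p [ x ]≔ outside ∣ ≡ ∣ p ∣
∣delete∣ (inside ∷ p) {zero} here = refl
∣delete∣ (inside ∷ p) {suc x} (there x∈) = cong suc (∣delete∣ p x∈)
∣delete∣ (outside ∷ p) {suc x} (there x∈) = ∣delete∣ p x∈

∣delete∣-≥ : ∀ {n} (p : Subset n) x → ∣ p ∣ ≤ suc ∣ p [ x ]≔ outside ∣
∣delete∣-≥ (inside ∷ p) zero = ≤-refl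
∣delete∣-≥ (outside ∷ p) zero = n≤1+n _
∣delete∣-≥ (inside ∷ p) (suc x) = s≤s (∣delete∣-≥ p x)
∣delete∣-≥ (outside ∷ p) (suc x) = ∣delete∣-≥ p x

∣∣>0⇒nonempty : ∀ {n} (p : Subset n) → 0 < ∣ p ∣ → Nonempty p
∣∣>0⇒nonempty {n} p 0< with nonempty? p
... | yes ne = ne
... | no empty with Empty-unique empty
...   | refl = ⊥-elim (<-irrefl (sym (∣⊥∣≡0 n)) 0<)

subsets : ∀ n → List (Subset n)
subsets zero = [] ∷ []
subsets (suc n) = map (inside ∷_) (subsets n) ++ map (outside ∷_) (subsets n)

∈-subsets : ∀ {n} (p : Subset n) → p ∈ subsets n
∈-subsets [] = here refl
∈-subsets (inside ∷ p) = ∈-++⁺ˡ (∈-map⁺ (inside ∷_) (∈-subsets p))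
∈-subsets {suc n} (outside ∷ p) = ∈-++⁺ʳ (map (inside ∷_) (subsets n)) (∈-map⁺ (outside ∷_) (∈-subsets p))

-- Kneser vertices: enumeration, stability, construction and repair of triples

module _ {k : ℕ} where

  private
    n = 6 + k

  _∈ᵛ_ : Fin n → Vertex k → Set
  x ∈ᵛ v = x ∈ˢ proj₁ v

  _∈ᵛ?_ : ∀ x v → Dec (x ∈ᵛ v)
  x ∈ᵛ? v = x ∈ˢ? proj₁ v

  vertex-≡ : {u v : Vertex k} → proj₁ u ≡ proj₁ v → u ≡ v
  vertex-≡ {_ , p} {_ , q} refl = cong (_ ,_) (≡-irrelevant p q)

  infix 4 _≟ᵛ_
  _≟ᵛ_ : DecidableEquality (Vertex k)
  u ≟ᵛ v = map′ vertex-≡ (cong proj₁) (≡-dec _≟ᵇ_ (proj₁ u) (proj₁ v))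

  triples : List (Subset n) → List (Vertex k)
  triples [] = []
  triples (s ∷ ss) with ∣ s ∣ ≟ 3
  ... | yes eq = (s , eq) ∷ triples ss
  ... | no _ = triples ss

  ∈-triples : ∀ {ss} (v : Vertex k) → proj₁ v ∈ ss → v ∈ triples ss
  ∈-triples {s ∷ ss} v v∈ with ∣ s ∣ ≟ 3 | v∈
  ... | yes eq | here s≡ = here (vertex-≡ s≡)
  ... | yes eq | there v∈′ = there (∈-triples v v∈′)
  ... | no ≢3 | here refl = ⊥-elim (≢3 (proj₂ v))
  ... | no ≢3 | there v∈′ = ∈-triples v v∈′

  opaque
    vertices : List (Vertex k)
    vertices = triples (subsets n)

    ∈-vertices : ∀ v → v ∈ vertices
    ∈-vertices v = ∈-triples v (∈-subsets (proj₁ v))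

  -- Hides the modular arithmetic of next, which conversion checking would otherwise keep unfolding.
  opaque
    succ : Fin n → Fin n
    succ = next {k}

    toℕ-succ : ∀ t → toℕ (succ t) ≡ suc (toℕ t) % n
    toℕ-succ t = toℕ-fromℕ< (m%n<n (suc (toℕ t)) n)

    stable⁻ : ∀ v → Stable v → ∀ {t} → t ∈ᵛ v → ¬ succ t ∈ᵛ v
    stable⁻ v stable t∈ st∈ = stable (_ , t∈ , st∈)

    stable⁺ : ∀ v → (∀ t → t ∈ᵛ v → ¬ succ t ∈ᵛ v) → Stable v
    stable⁺ v apart (t , t∈ , nt∈) = apart t t∈ nt∈

    unstable⁻ : ∀ v → ¬ Stable v → ∃ λ t → t ∈ᵛ v × succ t ∈ᵛ v
    unstable⁻ v = decidable-stable (any? λ t → (t ∈ᵛ? v) ×-dec (next {k} t ∈ᵛ? v))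

  anyVertex? : {P : Vertex k → Set} → Decidable P → Dec (∃ P)
  anyVertex? P? = map′ Any.satisfied (λ (v , Pv) → lose (∈-vertices v) Pv)
    (Any.any? P? vertices)

  stable? : Decidable (Stable {k})
  stable? v = map′ (stable⁺ v) (λ stable t → stable⁻ v stable)
    (all? λ t → (t ∈ᵛ? v) →-dec ¬? (succ t ∈ᵛ? v))

  -- Deleting two points from a set of size three leaves at least one. With `x` and `y` equal this
  -- also serves to pick a point of `v`.
  another : (v : Vertex k) (x y : Fin n) → ∃ λ z → z ∈ᵛ v × z ≢ x × z ≢ y
  another (s , ∣s∣≡3) x y = z
    , ∈-update⁻ s z≢x (∈-update⁻ (s [ x ]≔ outside) z≢y z∈)
    , z≢x , z≢y
    where
    3≤ : 3 ≤ suc (suc ∣ (s [ x ]≔ outside) [ y ]≔ outside ∣)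
    3≤ = ≤-trans (≤-reflexive (sym ∣s∣≡3))
           (≤-trans (∣delete∣-≥ s x) (s≤s (∣delete∣-≥ (s [ x ]≔ outside) y)))
    ne = ∣∣>0⇒nonempty ((s [ x ]≔ outside) [ y ]≔ outside) (≤-pred (≤-pred 3≤))
    z = proj₁ ne
    z∈ = proj₂ ne
    z≢y : z ≢ y
    z≢y z≡y = ∉-delete (s [ x ]≔ outside) y (subst (_∈ˢ _) z≡y z∈)
    z≢x : z ≢ x
    z≢x z≡x = ∉-delete s x (subst (_∈ˢ _) z≡x (∈-update⁻ (s [ x ]≔ outside) z≢y z∈))

  -- Having size three, a vertex contained in {x, y, z} is equal to it, so one inclusion determines
  -- it.
  record Triple (x y z : Fin n) : Set where
    field
      vertex : Vertex k
      only : ∀ {t} → t ∈ᵛ vertex → t ≡ x ⊎ t ≡ y ⊎ t ≡ z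

  triple : ∀ x y z → x ≢ y → x ≢ z → y ≢ z → Triple x y z
  triple x y z x≢y x≢z y≢z = record
    { vertex = p₃ , trans (∣insert∣ p₂ z∉) (cong suc (trans (∣insert∣ p₁ y∉) (cong suc (trans (∣insert∣ {n} ∅ {x} ∉⊥) (cong suc (∣⊥∣≡0 n))))))
    ; only = only₃ }
    where
    p₁ = ∅ [ x ]≔ inside
    p₂ = p₁ [ y ]≔ inside
    p₃ = p₂ [ z ]≔ inside
    only₁ : ∀ {t} → t ∈ˢ p₁ → t ≡ x
    only₁ {t} t∈ with t ≟ᶠ x
    ... | yes eq = eq
    ... | no t≢x = ⊥-elim (∉⊥ (∈-update⁻ ∅ t≢x t∈))
    only₂ : ∀ {t} → t ∈ˢ p₂ → t ≡ x ⊎ t ≡ y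
    only₂ {t} t∈ with t ≟ᶠ y
    ... | yes eq = inj₂ eq
    ... | no t≢y = inj₁ (only₁ (∈-update⁻ p₁ t≢y t∈))
    only₃ : ∀ {t} → t ∈ˢ p₃ → t ≡ x ⊎ t ≡ y ⊎ t ≡ z
    only₃ {t} t∈ with t ≟ᶠ z
    ... | yes eq = inj₂ (inj₂ eq)
    ... | no t≢z with only₂ (∈-update⁻ p₂ t≢z t∈)
    ...   | inj₁ eq = inj₁ eq
    ...   | inj₂ eq = inj₂ (inj₁ eq)
    y∉ : y ∉ˢ p₁
    y∉ y∈ = x≢y (sym (only₁ y∈))
    z∉ : z ∉ˢ p₂
    z∉ z∈ with only₂ z∈
    ... | inj₁ eq = x≢z (sym eq)
    ... | inj₂ eq = y≢z (sym eq)

  -- Moving the point `x` of `w` to `z` can break stability only at the two cyclic neighbours of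
  -- `z`; the last two hypotheses say that neither is in `w`, unless it is `x` itself.
  replace : (w : Vertex k) (x z : Fin n) → Stable w → x ∈ᵛ w → ¬ z ∈ᵛ w → succ z ≢ z →
    (∀ {t} → t ∈ᵛ w → succ t ≡ z → t ≡ x) → (succ z ∈ᵛ w → succ z ≡ x) →
    ∃ λ w′ → Stable w′ × (∀ {t} → t ∈ᵛ w′ → t ≡ z ⊎ (t ∈ᵛ w × t ≢ x))
  replace w x z stable x∈ z∉ nz≢z before after =
    (p₂ , ∣p₂∣≡3) , stable⁺ (p₂ , ∣p₂∣≡3) apart , members
    where
    p = proj₁ w
    p₁ = p [ x ]≔ outside
    p₂ = p₁ [ z ]≔ inside
    x≢z : x ≢ z
    x≢z refl = z∉ x∈
    z∉p₁ : z ∉ˢ p₁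
    z∉p₁ z∈ = z∉ (∈-update⁻ p (x≢z ∘ sym) z∈)
    members : ∀ {t} → t ∈ˢ p₂ → t ≡ z ⊎ (t ∈ˢ p × t ≢ x)
    members {t} t∈ with t ≟ᶠ z | t ≟ᶠ x
    ... | yes eq | _ = inj₁ eq
    ... | no t≢z | yes refl = ⊥-elim (∉-delete p x (∈-update⁻ p₁ t≢z t∈))
    ... | no t≢z | no t≢x = inj₂ (∈-update⁻ p t≢x (∈-update⁻ p₁ t≢z t∈) , t≢x)
    ∣p₂∣≡3 : ∣ p₂ ∣ ≡ 3
    ∣p₂∣≡3 = trans (∣insert∣ p₁ z∉p₁) (trans (∣delete∣ p x∈) (proj₂ w))
    apart : ∀ t → t ∈ˢ p₂ → ¬ succ t ∈ˢ p₂
    apart t t∈ nt∈ with members t∈ | members nt∈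
    ... | inj₁ refl | inj₁ eq = nz≢z eq
    ... | inj₁ refl | inj₂ (nz∈ , nz≢x) = nz≢x (after nz∈)
    ... | inj₂ (t∈w , t≢x) | inj₁ eq = t≢x (before t∈w eq)
    ... | inj₂ (t∈w , _) | inj₂ (nt∈w , _) = stable⁻ w stable t∈w nt∈w

  -- Positions on the cycle, counted from a base point

  at : Fin n → ℕ → Fin n
  at b zero = b
  at b (suc e) = succ (at b e)

  toℕ-at : ∀ b e → toℕ (at b e) ≡ (toℕ b + e) % n
  toℕ-at b zero = sym (trans (%-congˡ {o = n} (+-identityʳ (toℕ b))) (m<n⇒m%n≡m (toℕ<n b)))
  toℕ-at b (suc e) = begin
    toℕ (succ (at b e))                   ≡⟨ toℕ-succ (at b e) ⟩
    suc (toℕ (at b e)) % n                ≡⟨ %-congˡ {o = n} (cong suc (toℕ-at b e)) ⟩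
    (1 + (toℕ b + e) % n) % n             ≡⟨ %-distribˡ-+ 1 ((toℕ b + e) % n) n ⟩
    (1 % n + (toℕ b + e) % n % n) % n     ≡⟨ %-congˡ {o = n} (cong (1 % n +_) (m%n%n≡m%n (toℕ b + e) n)) ⟩
    (1 % n + (toℕ b + e) % n) % n         ≡⟨ sym (%-distribˡ-+ 1 (toℕ b + e) n) ⟩
    (1 + (toℕ b + e)) % n                 ≡⟨ %-congˡ {o = n} (sym (+-suc (toℕ b) e)) ⟩
    (toℕ b + suc e) % n                   ∎
    where open ≡-Reasoning

  at-wrap : ∀ b → at b n ≡ b
  at-wrap b = toℕ-injective (trans (toℕ-at b n) (trans ([m+n]%n≡m%n (toℕ b) n) (m<n⇒m%n≡m (toℕ<n b))))

  -- Compare quotients: equal ones give `i ≡ j`, a larger quotient for `i` gives `j ≤ i`, and a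
  -- smaller one would force `j ≥ i + n`.
  %-injective : ∀ {i j} → i ≤ j → j < i + n → i % n ≡ j % n → i ≡ j
  %-injective {i} {j} i≤j j<i+n eq with <-cmp (i / n) (j / n)
  ... | tri≈ _ q≡ _ = trans (m≡m%n+[m/n]*n i n) (trans (cong₂ (λ r q → r + q * n) eq q≡) (sym (m≡m%n+[m/n]*n j n)))
  ... | tri> _ _ q> = ≤-antisym i≤j (subst₂ _≤_ (sym (m≡m%n+[m/n]*n j n)) (sym (m≡m%n+[m/n]*n i n))
          (+-mono-≤ (≤-reflexive (sym eq)) (*-monoˡ-≤ n (<⇒≤ q>))))
  ... | tri< q< _ _ = ⊥-elim (<⇒≱ j<i+n (begin
      i + n                     ≡⟨ cong (_+ n) (m≡m%n+[m/n]*n i n) ⟩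
      i % n + i / n * n + n     ≡⟨ +-assoc (i % n) _ _ ⟩
      i % n + (i / n * n + n)   ≡⟨ cong₂ _+_ eq (+-comm (i / n * n) n) ⟩
      j % n + suc (i / n) * n   ≤⟨ +-monoʳ-≤ (j % n) (*-monoˡ-≤ n q<) ⟩
      j % n + j / n * n         ≡⟨ sym (m≡m%n+[m/n]*n j n) ⟩
      j                         ∎))
    where open ≤-Reasoning

  at-injective-≤ : ∀ b {i j} → i ≤ j → j < i + n → at b i ≡ at b j → i ≡ j
  at-injective-≤ b {i} {j} i≤j j<i+n eq = +-cancelˡ-≡ (toℕ b) i j
    (%-injective (+-monoʳ-≤ (toℕ b) i≤j)
      (≤-trans (+-monoʳ-< (toℕ b) j<i+n) (≤-reflexive (sym (+-assoc (toℕ b) i n))))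
      (trans (sym (toℕ-at b i)) (trans (cong toℕ eq) (toℕ-at b j))))

  -- Only the difference of the positions matters, so they may run past `n`; this is what
  -- comparisons across the base point use.
  at-injective : ∀ b {i j} → i < j + n → j < i + n → at b i ≡ at b j → i ≡ j
  at-injective b {i} {j} i< j< eq with ≤-total i j
  ... | inj₁ i≤j = at-injective-≤ b i≤j j< eq
  ... | inj₂ j≤i = sym (at-injective-≤ b j≤i i< (sym eq))

  at-injective-< : ∀ b {i j} → i < n → j < n → at b i ≡ at b j → i ≡ j
  at-injective-< b {i} {j} i< j< = at-injective b (≤-trans i< (m≤n+m n j)) (≤-trans j< (m≤n+m n i))

  at-surjective : ∀ b x → ∃ λ e → e < n × at b e ≡ x
  at-surjective b x with toℕ b ≤? toℕ x
  ... | yes b≤x = toℕ x ∸ toℕ b , ≤-<-trans (m∸n≤m (toℕ x) (toℕ b)) (toℕ<n x)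
      , toℕ-injective (trans (toℕ-at b _) (trans (%-congˡ {o = n} (m+[n∸m]≡n b≤x)) (m<n⇒m%n≡m (toℕ<n x))))
  ... | no b≰x = toℕ x + n ∸ toℕ b
      , +-cancelˡ-< (toℕ b) _ _ (subst (_< toℕ b + n) (sym (m+[n∸m]≡n b≤)) (+-monoˡ-< n (≰⇒> b≰x)))
      , toℕ-injective (trans (toℕ-at b _) (trans (%-congˡ {o = n} (m+[n∸m]≡n b≤))
          (trans ([m+n]%n≡m%n (toℕ x) n) (m<n⇒m%n≡m (toℕ<n x)))))
    where
    b≤ : toℕ b ≤ toℕ x + n
    b≤ = ≤-trans (<⇒≤ (toℕ<n b)) (m≤n+m n (toℕ x))

  succ-injective : ∀ {s t} → succ s ≡ succ t → s ≡ t
  succ-injective {s} {t} eq with at-surjective s t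
  -- With `t` written as position `e` from `s`, the hypothesis compares positions `1` and `e + 1`.
  ... | e , e<n , refl = cong (at s) (suc-injective (at-injective s {1} {suc e} (s≤s (≤-trans (s≤s z≤n) (m≤n+m n e))) (s≤s e<n) eq))

  succ-≢ : ∀ t → succ t ≢ t
  succ-≢ t eq with at-injective t {1} {0} (s≤s (s≤s z≤n)) (s≤s z≤n) eq
  ... | ()

  -- A stable vertex read once around the cycle from `b`; the two recorded gaps are those that do
  -- not pass through `b`.
  record Sorted (b : Fin n) (w : Vertex k) : Set where
    constructor sorted
    field
      {e f g} : ℕ
      e+2≤f : 2 + e ≤ f
      f+2≤g : 2 + f ≤ g
      g<n : g < n
      e∈ : at b e ∈ᵛ w
      f∈ : at b f ∈ᵛ w
      g∈ : at b g ∈ᵛ w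

  stable-gap : ∀ b w → Stable w → ∀ {e f} → e < f → at b e ∈ᵛ w → at b f ∈ᵛ w → 2 + e ≤ f
  stable-gap b w stable {e} {f} e<f e∈ f∈ with suc e ≟ f
  ... | yes refl = ⊥-elim (stable⁻ w stable e∈ f∈)
  ... | no ≢ = ≤∧≢⇒< e<f ≢

  sort-positions : ∀ b w → Stable w → ∀ {e f g} → e < n → f < n → g < n →
    at b e ∈ᵛ w → at b f ∈ᵛ w → at b g ∈ᵛ w → f ≢ e → g ≢ e → g ≢ f → Sorted b w
  sort-positions b w stable {e} {f} {g} e< f< g< e∈ f∈ g∈ f≢e g≢e g≢f with <-cmp e f | <-cmp f g | <-cmp e g
  ... | tri≈ _ e≡f _ | _ | _ = ⊥-elim (f≢e (sym e≡f))
  ... | _ | tri≈ _ f≡g _ | _ = ⊥-elim (g≢f (sym f≡g))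
  ... | _ | _ | tri≈ _ e≡g _ = ⊥-elim (g≢e (sym e≡g))
  ... | tri< e<f _ _ | tri< f<g _ _ | _ = sorted (stable-gap b w stable e<f e∈ f∈) (stable-gap b w stable f<g f∈ g∈) g< e∈ f∈ g∈
  ... | tri< e<f _ _ | tri> _ _ g<f | tri< e<g _ _ = sorted (stable-gap b w stable e<g e∈ g∈) (stable-gap b w stable g<f g∈ f∈) f< e∈ g∈ f∈
  ... | tri< e<f _ _ | tri> _ _ g<f | tri> _ _ g<e = sorted (stable-gap b w stable g<e g∈ e∈) (stable-gap b w stable e<f e∈ f∈) f< g∈ e∈ f∈
  ... | tri> _ _ f<e | tri< f<g _ _ | tri< e<g _ _ = sorted (stable-gap b w stable f<e f∈ e∈) (stable-gap b w stable e<g e∈ g∈) g< f∈ e∈ g∈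
  ... | tri> _ _ f<e | tri< f<g _ _ | tri> _ _ g<e = sorted (stable-gap b w stable f<g f∈ g∈) (stable-gap b w stable g<e g∈ e∈) e< f∈ g∈ e∈
  ... | tri> _ _ f<e | tri> _ _ g<f | _ = sorted (stable-gap b w stable g<f g∈ f∈) (stable-gap b w stable f<e f∈ e∈) e< g∈ f∈ e∈

  another-position : ∀ b w {e f} → ∃ λ g → g < n × at b g ∈ᵛ w × g ≢ e × g ≢ f
  another-position b w {e} {f} =
    let z , z∈ , z≢e , z≢f = another w (at b e) (at b f)
        g , g<n , at≡z = at-surjective b z
    in g , g<n , subst (_∈ᵛ w) (sym at≡z) z∈
       , (λ g≡e → z≢e (trans (sym at≡z) (cong (at b) g≡e))) , λ g≡f → z≢f (trans (sym at≡z) (cong (at b) g≡f))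

  opaque
    sort : ∀ b w → Stable w → Sorted b w
    sort b w stable =
      let e , e< , e∈ , _ = another-position b w {0} {0}
          f , f< , f∈ , f≢e , _ = another-position b w {e} {e}
          g , g< , g∈ , g≢e , g≢f = another-position b w {e} {f}
      in sort-positions b w stable e< f< g< e∈ f∈ g∈ f≢e g≢e g≢f

  opaque
    -- The three inequalities are the three cyclic gaps, the last one wrapping around; each is at
    -- least 2, so no two points are consecutive.
    stableTriple : ∀ b {e f g} → 2 + e ≤ f → 2 + f ≤ g → 2 + g ≤ e + n →
      Σ (Triple (at b e) (at b f) (at b g)) (Stable ∘ Triple.vertex)
    stableTriple b {e} {f} {g} e+2≤f f+2≤g g+2≤e+n = T , stable⁺ T.vertex gaps
      where
      e<f : e < f
      e<f = <-trans (n<1+n e) e+2≤f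
      f<g : f < g
      f<g = <-trans (n<1+n f) f+2≤g
      g<e+n : g < e + n
      g<e+n = <-trans (n<1+n g) g+2≤e+n
      f<e+n : f < e + n
      f<e+n = <-trans f<g g<e+n
      distinct : ∀ {i j} → i < j → j < i + n → at b i ≢ at b j
      distinct i<j j<i+n eq = <-irrefl (at-injective-≤ b (<⇒≤ i<j) j<i+n eq) i<j
      T : Triple (at b e) (at b f) (at b g)
      T = triple (at b e) (at b f) (at b g) (distinct e<f f<e+n) (distinct (<-trans e<f f<g) g<e+n)
            (distinct f<g (≤-trans g<e+n (+-monoˡ-≤ n (<⇒≤ e<f))))
      module T = Triple T
      -- Two positions in [e , e + n ∸ 2] that are not consecutive are not consecutive modulo n either.
      apart : ∀ {i j} → e ≤ i → i ≤ g → e ≤ j → j ≤ g → suc i ≢ j → at b (suc i) ≢ at b j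
      apart e≤i i≤g e≤j j≤g ≢j eq = ≢j (at-injective b
        (≤-trans (s≤s (s≤s i≤g)) (≤-trans g+2≤e+n (+-monoˡ-≤ n e≤j)))
        (≤-trans (s≤s j≤g) (≤-trans g<e+n (+-monoˡ-≤ n (m≤n⇒m≤1+n e≤i)))) eq)
      e≤f : e ≤ f
      e≤f = <⇒≤ e<f
      f≤g : f ≤ g
      f≤g = <⇒≤ f<g
      e≤g : e ≤ g
      e≤g = ≤-trans e≤f f≤g
      gaps : ∀ t → t ∈ᵛ T.vertex → ¬ succ t ∈ᵛ T.vertex
      gaps t t∈ nt∈ with T.only t∈ | T.only nt∈
      ... | inj₁ refl | inj₁ eq = succ-≢ _ eq
      ... | inj₁ refl | inj₂ (inj₁ eq) = apart ≤-refl e≤g e≤f f≤g (<⇒≢ e+2≤f) eq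
      ... | inj₁ refl | inj₂ (inj₂ eq) = apart ≤-refl e≤g e≤g ≤-refl (<⇒≢ (<-trans e+2≤f f<g)) eq
      ... | inj₂ (inj₁ refl) | inj₁ eq = apart e≤f f≤g ≤-refl e≤g (≢-sym (<⇒≢ (m≤n⇒m≤1+n e<f))) eq
      ... | inj₂ (inj₁ refl) | inj₂ (inj₁ eq) = succ-≢ _ eq
      ... | inj₂ (inj₁ refl) | inj₂ (inj₂ eq) = apart e≤f f≤g e≤g ≤-refl (<⇒≢ f+2≤g) eq
      ... | inj₂ (inj₂ refl) | inj₁ eq = apart e≤g ≤-refl ≤-refl e≤g (≢-sym (<⇒≢ (s≤s e≤g))) eq
      ... | inj₂ (inj₂ refl) | inj₂ (inj₁ eq) = apart e≤g ≤-refl e≤f f≤g (≢-sym (<⇒≢ (s≤s f≤g))) eq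
      ... | inj₂ (inj₂ refl) | inj₂ (inj₂ eq) = succ-≢ _ eq

  open DecMembership _≟ᵛ_ using (_∈?_; _∉?_)
  open DecMembership (_≟ᶠ_ {n}) using () renaming (_∈?_ to _∈ᶠ?_)

  -- Simplices containing an unstable vertex

  Covered : Fin n → Complex (Vertex k)
  Covered x γ = Any (x ∈ᵛ_) γ

  covered? : ∀ x → Decidable (Covered x)
  covered? x γ = Any.any? (x ∈ᵛ?_) γ

  covered-mono : ∀ x → Monotone (Covered x)
  covered-mono x γ⊆δ = Any-resp-⊆ γ⊆δ

  -- For simplices with an unstable vertex this amounts to having a common neighbour in `S k`; for
  -- simplices of stable vertices it singles out the faces that survive.
  StablyBounded : Complex (Vertex k)
  StablyBounded γ = ∃ λ w → Stable w × All (λ v → Disjoint v w) γ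

  disjoint? : ∀ (v w : Vertex k) → Dec (Disjoint v w)
  disjoint? v w = all? λ i → (i ∈ᵛ? v) →-dec ¬? (i ∈ᵛ? w)

  stablyBounded? : Decidable StablyBounded
  stablyBounded? γ = anyVertex? λ w → stable? w ×-dec All.all? (λ v → disjoint? v w) γ

  stablyBounded-anti : ∀ {γ δ} → γ ⊆ δ → StablyBounded δ → StablyBounded γ
  stablyBounded-anti γ⊆δ (w , stable , disjoint) = w , stable , All-resp-⊇ γ⊆δ disjoint

  covered-∉ : ∀ {γ x} (w : Vertex k) → All (λ v → Disjoint v w) γ → Covered x γ → ¬ x ∈ᵛ w
  covered-∉ w disj covered = let disjoint , x∈v = All.lookupAny disj covered in disjoint _ x∈v

  uncovered-∉ : ∀ {γ v} {x} → v ∈ γ → ¬ Covered x γ → ¬ x ∈ᵛ v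
  uncovered-∉ v∈γ ¬cov x∈v = ¬cov (lose v∈γ x∈v)

  -- The unstable vertices in `u ∷ us` are present and those in `outs` absent, which toggling a
  -- stable apex does not disturb. The bounds on `y` keep positions `0` and `y` at least two apart
  -- in both directions.
  module UnstablePart (u : Vertex k) (us outs : List (Vertex k))
    (ins-unstable : ∀ {v} → v ∈ u ∷ us → ¬ Stable v) (outs-unstable : ∀ {v} → v ∈ outs → ¬ Stable v)
    (b : Fin n) (y : ℕ) (0∈u : at b 0 ∈ᵛ u) (1∈u : at b 1 ∈ᵛ u) (y∈u : at b y ∈ᵛ u)
    (2≤y : 2 ≤ y) (y+2≤n : 2 + y ≤ n) where

    ins = u ∷ us

    R : Complex (Vertex k)
    R γ = All (_∈ γ) ins × All (_∉ γ) outs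

    Range : ℕ → ℕ → Complex (Vertex k)
    Range lo hi γ = ∀ {e} → e < hi → lo ≤ e → Covered (at b e) γ

    -- The positions from `lo` up to but excluding `hi` are those already known to be covered; this
    -- run grows first upward from `y`, then downward.
    M : ℕ → ℕ → Complex (Vertex k)
    M lo hi γ = R γ × StablyBounded γ × Range lo hi γ

    from-u : ∀ {x γ} → x ∈ᵛ u → R γ → Covered x γ
    from-u x∈u (u∈γ ∷ _ , _) = lose u∈γ x∈u

    -- A common neighbour w through at b m is repaired by moving at b m to its neighbour at b j,
    -- which no vertex of the simplex covers; this makes room for the apex a.
    module Cone (lo hi j m : ℕ) (a : Vertex k) (a-stable : Stable a)
      (a-only : ∀ {x} → x ∈ᵛ a → (x ∈ᵛ u) ⊎ x ≡ at b m)
      (m-outside : ∀ {e} → e < hi → lo ≤ e → at b e ≢ at b m)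
      (j≢m : at b m ≢ at b j)
      (adjacent : ∀ w → Stable w → at b m ∈ᵛ w → ¬ at b j ∈ᵛ w)
      (before : ∀ {γ} → M lo hi γ → ∀ w → All (λ v → Disjoint v w) γ →
         ∀ {s} → s ∈ᵛ w → succ s ≡ at b j → s ≡ at b m)
      (after : ∀ {γ} → M lo hi γ → ∀ w → All (λ v → Disjoint v w) γ →
         succ (at b j) ∈ᵛ w → succ (at b j) ≡ at b m) where

      x z : Fin n
      x = at b m
      z = at b j

      N : Complex (Vertex k)
      N = M lo hi ∩ ∁ (Covered z)

      N? : Decidable N
      N? γ = ((All.all? (_∈? γ) ins ×-dec All.all? (λ v → ¬? (v ∈? γ)) outs)
               ×-dec (stablyBounded? γ
               ×-dec allUpTo? (λ e → (lo ≤? e) →-dec covered? (at b e) γ) hi))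
             ×-dec ¬? (covered? z γ)

      ext : Extensional N
      ext γ⊆δ δ⊆γ (((in-γ , out-γ) , bounded , range) , ¬z) =
        ((All.map γ⊆δ in-γ , All.map (_∘ δ⊆γ) out-γ) , stablyBounded-anti δ⊆γ bounded
        , λ e< ≤e → covered-mono _ γ⊆δ (range e< ≤e)) , ¬z ∘ covered-mono z δ⊆γ

      add : ∀ {γ} → N γ → N (a ∷ γ)
      add {γ} (Mγ@(Rγ@(in-γ , out-γ) , (w , w-stable , disj) , range) , ¬z) =
        ((All.map there in-γ , All.tabulate out′) , bounded , λ e< ≤e → there (range e< ≤e)) , ¬z′
        where
        out′ : ∀ {v} → v ∈ outs → v ∉ a ∷ γ
        out′ v∈ (here refl) = outs-unstable v∈ a-stable
        out′ v∈ (there v∈γ) = All.lookup out-γ v∈ v∈γ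
        ¬z′ : ¬ Covered z (a ∷ γ)
        ¬z′ (there c) = ¬z c
        ¬z′ (here z∈a) with a-only z∈a
        ... | inj₁ z∈u = ¬z (from-u z∈u Rγ)
        ... | inj₂ z≡x = j≢m (sym z≡x)
        bounded : StablyBounded (a ∷ γ)
        bounded with x ∈ᵛ? w
        -- All points of `a` other than `x` lie in `u`, hence are covered and avoid `w` already.
        ... | no x∉w = w , w-stable , disjoint-a ∷ disj
          where
          disjoint-a : Disjoint a w
          disjoint-a i i∈a i∈w with a-only i∈a
          ... | inj₁ i∈u = covered-∉ w disj (from-u i∈u Rγ) i∈w
          ... | inj₂ refl = x∉w i∈w
        ... | yes x∈w with replace w x z w-stable x∈w (adjacent w w-stable x∈w) (succ-≢ z) (before Mγ w disj) (after Mγ w disj)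
        ...   | w′ , w′-stable , members = w′ , w′-stable , disjoint-a ∷ All.tabulate disjoint-γ
          where
          disjoint-γ : ∀ {v} → v ∈ γ → Disjoint v w′
          disjoint-γ v∈γ i i∈v i∈w′ with members i∈w′
          ... | inj₁ refl = uncovered-∉ v∈γ ¬z i∈v
          ... | inj₂ (i∈w , _) = All.lookup disj v∈γ i i∈v i∈w
          disjoint-a : Disjoint a w′
          disjoint-a i i∈a i∈w′ with a-only i∈a | members i∈w′
          ... | inj₁ i∈u | inj₁ refl = ¬z (from-u i∈u Rγ)
          ... | inj₁ i∈u | inj₂ (i∈w , _) = covered-∉ w disj (from-u i∈u Rγ) i∈w
          ... | inj₂ refl | inj₁ x≡z = j≢m x≡z
          ... | inj₂ refl | inj₂ (_ , x≢x) = x≢x refl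

      drop : ∀ {γ} → N (a ∷ γ) → N γ
      drop {γ} (((in-γ , out-γ) , bounded , range) , ¬z) =
        (Rγ , stablyBounded-anti there bounded , range′) , ¬z ∘ there
        where
        in′ : ∀ {v} → v ∈ ins → v ∈ γ
        in′ v∈ with All.lookup in-γ v∈
        ... | here refl = ⊥-elim (ins-unstable v∈ a-stable)
        ... | there v∈γ = v∈γ
        Rγ : R γ
        Rγ = All.tabulate in′ , All.map (_∘ there) out-γ
        range′ : Range lo hi γ
        range′ e< ≤e with range e< ≤e
        ... | there c = c
        -- The range avoids position `m`, so the apex can cover a point of it only where `u` does
        -- too.
        ... | here e∈a with a-only e∈a
        ...   | inj₁ e∈u = from-u e∈u Rγ
        ...   | inj₂ eq = ⊥-elim (m-outside e< ≤e eq)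

      removable : Removable N
      removable = removable-cone _≟ᵛ_ vertices ∈-vertices a N? ext add drop

    third-outside : ∀ {p q r x} → p ∈ᵛ u → q ∈ᵛ u → x ≡ p ⊎ x ≡ q ⊎ x ≡ r → (x ∈ᵛ u) ⊎ x ≡ r
    third-outside p∈ q∈ (inj₁ refl) = inj₁ p∈
    third-outside p∈ q∈ (inj₂ (inj₁ refl)) = inj₁ q∈
    third-outside p∈ q∈ (inj₂ (inj₂ eq)) = inj₂ eq

    -- The predecessor of `j` lies in the covered run starting at `y`, so a common neighbour
    -- containing `j + 1` may trade it for `j`. The bound on `j` keeps `j + 1` and `0` two apart.
    ascend-cone : ∀ {j} → y < j → j ≤ 3 + k → Removable (M y j ∩ ∁ (Covered (at b j)))
    ascend-cone {suc j′} y<j@(s≤s y≤j′) j≤3+k =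
      Cone.removable y j j m T.vertex (proj₂ triple′)
        (third-outside 0∈u y∈u ∘ T.only)
        (λ e<j _ eq → <⇒≢ (m<n⇒m<1+n e<j) (at-injective-< b (<-trans e<j j<n) m<n eq))
        (succ-≢ _)
        (λ w stable m∈ j∈ → stable⁻ w stable j∈ m∈)
        (λ (Rγ , _ , range) w disj s∈w eq →
          ⊥-elim (covered-∉ w disj (range ≤-refl y≤j′) (subst (_∈ᵛ w) (succ-injective eq) s∈w)))
        (λ _ _ _ _ → refl)
      where
      j = suc j′
      m = suc j
      m≤4+k : m ≤ 4 + k
      m≤4+k = s≤s j≤3+k
      m<n : m < n
      m<n = s≤s (m≤n⇒m≤1+n m≤4+k)
      j<n : j < n
      j<n = <-trans (n<1+n j) m<n
      triple′ = stableTriple b {0} {y} {m} 2≤y (s≤s y<j) (s≤s (s≤s m≤4+k))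
      module T = Triple (proj₁ triple′)

    -- Mirror image of `ascend-cone`: now `i + 1` is covered, so `i - 1` may be traded for `i`. The
    -- bound `3 ≤ i` keeps `i - 1` and `0` two apart.
    descend-cone : ∀ {i} → 3 ≤ i → suc i ≤ y → Removable (M (suc i) (4 + k) ∩ ∁ (Covered (at b i)))
    descend-cone {suc m} (s≤s 2≤m) i<y =
      Cone.removable (suc i) (4 + k) i m T.vertex (proj₂ triple′)
        (third-outside 0∈u y∈u ∘ Sum.map₂ Sum.swap ∘ T.only)
        (λ e< i<e eq → <⇒≢ (<-trans (n<1+n m) i<e) (sym (at-injective-< b (m≤n⇒m≤1+n (m≤n⇒m≤1+n e<)) m<n eq)))
        (≢-sym (succ-≢ _))
        (λ w stable m∈ i∈ → stable⁻ w stable m∈ i∈)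
        (λ _ _ _ _ → succ-injective)
        (λ (Rγ , _ , range) w disj si∈w → ⊥-elim (covered-∉ w disj (above Rγ range) si∈w))
      where
      i = suc m
      y<n : y < n
      y<n = <-trans (n<1+n y) y+2≤n
      m<n : m < n
      m<n = <-trans (<-trans (n<1+n m) i<y) y<n
      triple′ = stableTriple b {0} {m} {y} 2≤m i<y y+2≤n
      module T = Triple (proj₁ triple′)
      above : ∀ {γ} → R γ → Range (suc i) (4 + k) γ → Covered (at b (suc i)) γ
      above Rγ range with m≤n⇒m<n∨m≡n i<y
      ... | inj₁ i+1<y = range (≤-trans i+1<y (≤-pred (≤-pred y+2≤n))) ≤-refl
      -- Here `i + 1 = y`, which may be `n - 2` and so beyond the range, but `u` covers it.
      ... | inj₂ refl = from-u y∈u Rγ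

    -- As `0` and `1` are covered, a stable common neighbour starts at position 2 or later. Its
    -- middle point is then at least 4 and at most `n - 3`, which is inside the covered range.
    M-empty : ∀ {lo γ} → lo ≤ 3 → ¬ M lo (4 + k) γ
    M-empty lo≤3 (Rγ , (w , stable , disj) , range) = absurd (sort b w stable)
      where
      absurd : ¬ Sorted b w
      absurd (sorted {zero} _ _ _ e∈ _ _) = covered-∉ w disj (from-u 0∈u Rγ) e∈
      absurd (sorted {suc zero} _ _ _ e∈ _ _) = covered-∉ w disj (from-u 1∈u Rγ) e∈
      absurd (sorted {suc (suc e)} {f} e+2≤f f+2≤g g<n _ f∈ _) with f <? 4 + k
      ... | yes f< = covered-∉ w disj (range f< (≤-trans lo≤3 (≤-trans (s≤s (s≤s (s≤s z≤n))) e+2≤f))) f∈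
      ... | no f≮ = <⇒≱ g<n (≤-trans (s≤s (s≤s (≮⇒≥ f≮))) f+2≤g)

    -- Each step tests the position just below the run: if uncovered, the cone applies; if covered,
    -- the run grows. At `lo ≤ 3` nothing is left.
    descend : ∀ lo → lo ≤ y → Removable (M lo (4 + k))
    descend (suc lo@(suc (suc (suc _)))) lo<y =
      removable-split (covered? (at b lo)) (covered-mono (at b lo))
        (removable-resp-≅ (λ γ → mk⇔ extend shrink) (descend lo (<⇒≤ lo<y)))
        (descend-cone (s≤s (s≤s (s≤s z≤n))) lo<y)
      where
      extend : ∀ {γ} → (M (suc lo) (4 + k) ∩ Covered (at b lo)) γ → M lo (4 + k) γ
      extend {γ} ((Rγ , bounded , range) , c) = Rγ , bounded , range′
        where
        range′ : Range lo (4 + k) γ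
        range′ e< lo≤e with m≤n⇒m<n∨m≡n lo≤e
        ... | inj₁ lo<e = range e< lo<e
        ... | inj₂ refl = c
      shrink : ∀ {γ} → M lo (4 + k) γ → (M (suc lo) (4 + k) ∩ Covered (at b lo)) γ
      shrink {γ} (Rγ , bounded , range) = (Rγ , bounded , λ e< lo<e → range e< (<⇒≤ lo<e)) , c
        where
        c : Covered (at b lo) γ
        c = range (≤-trans lo<y (≤-pred (≤-pred y+2≤n))) ≤-refl
    descend 0 _ = removable-empty (M-empty z≤n)
    descend 1 _ = removable-empty (M-empty (s≤s z≤n))
    descend 2 _ = removable-empty (M-empty (s≤s (s≤s z≤n)))
    descend 3 _ = removable-empty (M-empty ≤-refl)

    -- The counter `d` is the distance from the end of the run to `n - 2`; once it is zero, the
    -- search turns downward from `y`.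
    ascend : ∀ d j → d + j ≡ 4 + k → y < j → Removable (M y j)
    ascend zero j refl y<j = descend y ≤-refl
    ascend (suc d) j d+j≡ y<j =
      removable-split (covered? (at b j)) (covered-mono (at b j))
        (removable-resp-≅ (λ γ → mk⇔ extend
            (λ (Rγ , bounded , range) → (Rγ , bounded , λ e< y≤e → range (m<n⇒m<1+n e<) y≤e) , range ≤-refl (<⇒≤ y<j)))
          (ascend d (suc j) (trans (+-suc d j) d+j≡) (m<n⇒m<1+n y<j)))
        (ascend-cone y<j (≤-pred (≤-trans (s≤s (m≤n+m j d)) (≤-reflexive d+j≡))))
      where
      extend : ∀ {γ} → (M y j ∩ Covered (at b j)) γ → M y (suc j) γ
      extend {γ} ((Rγ , bounded , range) , c) = Rγ , bounded , range′
        where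
        range′ : Range y (suc j) γ
        range′ (s≤s e≤j) y≤e with m≤n⇒m<n∨m≡n e≤j
        ... | inj₁ e<j = range e<j y≤e
        ... | inj₂ refl = c

    removable : Removable (λ γ → R γ × StablyBounded γ)
    removable with m≤n⇒m<n∨m≡n (≤-pred (≤-pred y+2≤n))
    -- For `y = n - 2` there is nothing to ascend through, and the run starts out empty.
    ... | inj₂ refl = removable-resp-≅
      (λ γ → mk⇔ (λ (Rγ , bounded) → Rγ , bounded , λ e< y≤e → ⊥-elim (<⇒≱ e< y≤e))
                 (λ (Rγ , bounded , _) → Rγ , bounded))
      (descend y ≤-refl)
    ... | inj₁ y<4+k = removable-resp-≅
      (λ γ → mk⇔ (λ (Rγ , bounded) → Rγ , bounded
                    , λ e≤y y≤e → subst (λ e → Covered (at b e) γ) (≤-antisym y≤e (≤-pred e≤y)) (from-u y∈u Rγ))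
                 (λ (Rγ , bounded , _) → Rγ , bounded))
      (ascend (4 + k ∸ suc y) (suc y) (m∸n+n≡m y<4+k) (n<1+n y))

  unstable-positions : (u : Vertex k) → ¬ Stable u →
    ∃ λ b → ∃ λ y → at b 0 ∈ᵛ u × at b 1 ∈ᵛ u × at b y ∈ᵛ u × 2 ≤ y × 2 + y ≤ n
  unstable-positions u unstable with unstable⁻ u unstable
  ... | t , t∈ , nt∈ with another u t (succ t)
  ... | x , x∈ , x≢t , x≢nt with at-surjective t x
  ... | zero , _ , refl = ⊥-elim (x≢t refl)
  ... | suc zero , _ , refl = ⊥-elim (x≢nt refl)
  ... | y@(suc (suc _)) , y<n , refl with m≤n⇒m<n∨m≡n y<n
  ...   | inj₁ y+2≤n = t , y , t∈ , nt∈ , x∈ , s≤s (s≤s z≤n) , y+2≤n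
  -- The third point precedes `t`, so the vertex is three consecutive points; based at the first of
  -- them, the third is at position 2.
  ...   | inj₂ y+1≡n = at t y , 2 , x∈ , subst (_∈ᵛ u) (sym back) t∈
          , subst (_∈ᵛ u) (cong succ (sym back)) nt∈ , ≤-refl , s≤s (s≤s (s≤s (s≤s z≤n)))
    where
    back : at t (suc y) ≡ t
    back = trans (cong (at t) y+1≡n) (at-wrap t)

  -- The pieces are indexed by the set of unstable vertices present. That set is nonempty, and its
  -- first listed member plays the role of `u`.
  unstable-removable :
    Removable (λ γ → Any (¬_ ∘ Stable) γ × StablyBounded γ)
  unstable-removable =
    removable-fibres _≟ᵛ_ {P = λ v γ → v ∈ γ} (λ v γ → v ∈? γ) (λ v γ⊆δ → γ⊆δ) unstables fibre
    where
    unstables = filter (¬? ∘ stable?) vertices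
    fibre : ∀ ins outs → (∀ {v} → v ∈ unstables → v ∈ ins ⊎ v ∈ outs) →
      (∀ {v} → v ∈ ins ⊎ v ∈ outs → v ∈ unstables) → (∀ {v} → v ∈ ins → v ∉ outs) →
      Removable (λ γ → (Any (¬_ ∘ Stable) γ × StablyBounded γ) × All (_∈ γ) ins × All (_∉ γ) outs)
    fibre ins outs complete sound _ = go ins complete unstable
      where
      unstable : ∀ {v} → v ∈ ins ⊎ v ∈ outs → ¬ Stable v
      unstable v∈ = proj₂ (∈-filter⁻ (¬? ∘ stable?) {xs = vertices} (sound v∈))
      go : ∀ ins → (∀ {v} → v ∈ unstables → v ∈ ins ⊎ v ∈ outs) → (∀ {v} → v ∈ ins ⊎ v ∈ outs → ¬ Stable v) →
        Removable (λ γ → (Any (¬_ ∘ Stable) γ × StablyBounded γ) × All (_∈ γ) ins × All (_∉ γ) outs)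
      go [] complete _ = removable-empty empty
        where
        empty : ∀ {γ} → ¬ ((Any (¬_ ∘ Stable) γ × StablyBounded γ) × All (_∈ γ) [] × All (_∉ γ) outs)
        empty ((any , _) , _ , out-γ) with find any
        ... | v , v∈γ , ¬stable with complete (∈-filter⁺ (¬? ∘ stable?) (∈-vertices v) ¬stable)
        ...   | inj₂ v∈outs = All.lookup out-γ v∈outs v∈γ
      go (u ∷ us) complete unstable with unstable-positions u (unstable (inj₁ (here refl)))
      ... | b , y , 0∈u , 1∈u , y∈u , 2≤y , y+2≤n =
        removable-resp-≅
          (λ γ → mk⇔ (λ ((_ , bounded) , Rγ) → Rγ , bounded)
                     (λ { (Rγ@(u∈γ ∷ _ , _) , bounded) →
                        (lose u∈γ (unstable (inj₁ (here refl))) , bounded) , Rγ }))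
          (UnstablePart.removable u us outs (unstable ∘ inj₁) (unstable ∘ inj₂) b y 0∈u 1∈u y∈u 2≤y y+2≤n)

  -- Simplices of stable vertices without a stable common neighbour

  infix 4 _⊆ᵛ_
  _⊆ᵛ_ : Vertex k → List (Fin n) → Set
  v ⊆ᵛ V = ∀ {x} → x ∈ᵛ v → x ∈ V

  -- Certificates that the covers of V by stable triples inside V can be matched perfectly:
  -- toggle a as long as the other triples still cover V, and otherwise let V′ be the part they cover.
  data Reducible (V : List (Fin n)) : Set where
    uncoverable : ∀ {x} → x ∈ V → (∀ v → Stable v → ¬ v ⊆ᵛ V) → Reducible V
    reduce : ∀ a → Stable a → a ⊆ᵛ V →
      (∀ V′ → V′ ⊆ V → (∀ {x} → x ∈ V → x ∉ V′ → x ∈ᵛ a) → (∃ λ x → x ∈ᵛ a × x ∉ V′) → Reducible V′) →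
      Reducible V

  -- The triples in `π` are forced to be present, so coverage is counted among the remaining ones.
  CoveredWithout : List (Vertex k) → Fin n → Complex (Vertex k)
  CoveredWithout π x γ = Any (λ v → v ∉ π × x ∈ᵛ v) γ

  coveredWithout? : ∀ π x → Decidable (CoveredWithout π x)
  coveredWithout? π x = Any.any? λ v → (v ∉? π) ×-dec (x ∈ᵛ? v)

  coveredWithout-mono : ∀ π x → Monotone (CoveredWithout π x)
  coveredWithout-mono π x γ⊆δ = Any-resp-⊆ γ⊆δ

  coveredWithout-tail : ∀ {a π x γ} → CoveredWithout (a ∷ π) x γ → CoveredWithout π x γ
  coveredWithout-tail = Any.map λ (v∉ , x∈v) → v∉ ∘ there , x∈v

  coveredWithout-head : ∀ {a π x γ} → CoveredWithout (a ∷ π) x (a ∷ γ) → CoveredWithout (a ∷ π) x γ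
  coveredWithout-head (here (a∉ , _)) = ⊥-elim (a∉ (here refl))
  coveredWithout-head (there c) = c

  coveredWithout-cases : ∀ {a π x γ} → CoveredWithout π x γ →
    CoveredWithout (a ∷ π) x γ ⊎ (a ∈ γ × x ∈ᵛ a)
  coveredWithout-cases {a} (here {v} (v∉ , x∈v)) with v ≟ᵛ a
  ... | yes refl = inj₂ (here refl , x∈v)
  ... | no v≢a = inj₁ (here ((λ { (here eq) → v≢a eq ; (there v∈π) → v∉ v∈π }) , x∈v))
  coveredWithout-cases (there c) with coveredWithout-cases c
  ... | inj₁ c′ = inj₁ (there c′)
  ... | inj₂ (a∈γ , x∈a) = inj₂ (there a∈γ , x∈a)

  coveredWithout-intro : ∀ {π x γ v} → v ∈ γ → v ∉ π → x ∈ᵛ v → CoveredWithout π x γ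
  coveredWithout-intro v∈γ v∉π x∈v = lose v∈γ (v∉π , x∈v)

  -- π consists of triples already forced to be present; V and W partition the ground set.
  StableCovers : List (Vertex k) → List (Fin n) → List (Fin n) → Complex (Vertex k)
  StableCovers π V W γ = (All (_∈ γ) π × All Stable γ) ×
    All (λ x → CoveredWithout π x γ) V × All (λ x → ¬ CoveredWithout π x γ) W

  stableCovers? : ∀ π V W → Decidable (StableCovers π V W)
  stableCovers? π V W γ = (All.all? (_∈? γ) π ×-dec All.all? stable? γ) ×-dec
    (All.all? (λ x → coveredWithout? π x γ) V ×-dec All.all? (λ x → ¬? (coveredWithout? π x γ)) W)

  stableCovers-ext : ∀ π V W → Extensional (StableCovers π V W)
  stableCovers-ext π V W γ⊆δ δ⊆γ ((π⊆γ , stable) , covered , uncovered) =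
    (All.map γ⊆δ π⊆γ , All-resp-⊇ δ⊆γ stable)
    , All.map (coveredWithout-mono π _ γ⊆δ) covered , All.map (_∘ coveredWithout-mono π _ δ⊆γ) uncovered

  covers-within : ∀ {π V W γ v} → (∀ x → x ∈ V ⊎ x ∈ W) → StableCovers π V W γ →
    v ∈ γ → v ∉ π → v ⊆ᵛ V
  covers-within total (_ , _ , uncovered) v∈γ v∉π {x} x∈v with total x
  ... | inj₁ x∈V = x∈V
  ... | inj₂ x∈W = ⊥-elim (All.lookup uncovered x∈W (coveredWithout-intro v∈γ v∉π x∈v))

  SplitCovers : List (Vertex k) → List (Fin n) → List (Fin n) → Vertex k → List (Fin n) → List (Fin n) →
    Complex (Vertex k)
  SplitCovers π V W a V′ W′ γ = StableCovers π V W γ ×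
    All (λ x → CoveredWithout (a ∷ π) x γ) V′ × All (λ x → ¬ CoveredWithout (a ∷ π) x γ) W′

  -- When every point of `a` is covered by other triples outside `π`, adding or dropping `a` changes
  -- no covered set.
  module ApexCone (π : List (Vertex k)) (V W : List (Fin n)) (a : Vertex k) (a-stable : Stable a) (a∉π : a ∉ π)
    (V′ W′ : List (Fin n)) (a⊆V′ : a ⊆ᵛ V′) where

    N : Complex (Vertex k)
    N = SplitCovers π V W a V′ W′

    N? : Decidable N
    N? γ = stableCovers? π V W γ ×-dec (All.all? (λ x → coveredWithout? (a ∷ π) x γ) V′
             ×-dec All.all? (λ x → ¬? (coveredWithout? (a ∷ π) x γ)) W′)

    ext : Extensional N
    ext γ⊆δ δ⊆γ (covers , covered , uncovered) =
      stableCovers-ext π V W γ⊆δ δ⊆γ covers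
      , All.map (coveredWithout-mono (a ∷ π) _ γ⊆δ) covered , All.map (_∘ coveredWithout-mono (a ∷ π) _ δ⊆γ) uncovered

    strip : ∀ {γ} → All (λ x → CoveredWithout (a ∷ π) x γ) V′ → ∀ {x} →
      CoveredWithout π x (a ∷ γ) → CoveredWithout π x γ
    strip covered′ (here (_ , x∈a)) = coveredWithout-tail (All.lookup covered′ (a⊆V′ x∈a))
    strip covered′ (there c) = c

    add : ∀ {γ} → N γ → N (a ∷ γ)
    add (((π⊆γ , stable) , covered , uncovered) , covered′ , uncovered′) =
      ((All.map there π⊆γ , a-stable ∷ stable) , All.map there covered , All.map (_∘ strip covered′) uncovered)
      , All.map there covered′ , All.map (_∘ coveredWithout-head) uncovered′

    drop : ∀ {γ} → N (a ∷ γ) → N γ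
    drop {γ} (((π⊆aγ , _ ∷ stable) , covered , uncovered) , covered′ , uncovered′) =
      ((All.tabulate π⊆γ , stable) , All.map (strip covered″) covered , All.map (_∘ there) uncovered)
      , covered″ , All.map (_∘ there) uncovered′
      where
      covered″ = All.map coveredWithout-head covered′
      π⊆γ : ∀ {p} → p ∈ π → p ∈ γ
      π⊆γ p∈π with All.lookup π⊆aγ p∈π
      ... | here refl = ⊥-elim (a∉π p∈π)
      ... | there p∈γ = p∈γ

    removable : Removable N
    removable = removable-cone _≟ᵛ_ vertices ∈-vertices a N? ext add drop

  -- Induction on the certificate, splitting by the set `V′` covered without `a`. If `V′` contains
  -- `a`, toggle `a`; otherwise `a` is forced and joins `π`. That no member of `π` fits inside `V`
  -- guarantees that the apex is new, and persists because `V′` misses a point of `a`.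
  stableCovers-removable : ∀ {V} → Reducible V → ∀ π W →
    (∀ x → x ∈ V ⊎ x ∈ W) → (∀ {x} → x ∈ V → x ∉ W) → (∀ {p} → p ∈ π → ¬ p ⊆ᵛ V) →
    Removable (StableCovers π V W)
  stableCovers-removable (uncoverable x∈V none) π W total _ _ =
    removable-empty λ covers@((_ , stable) , covered , _) →
      let v , v∈γ , v∉π , _ = find (All.lookup covered x∈V)
      in none v (All.lookup stable v∈γ) (covers-within total covers v∈γ v∉π)
  stableCovers-removable {V} (reduce a a-stable a⊆V rest) π W total disjoint π⊈V =
    removable-fibres (_≟ᶠ_ {n}) {P = λ x γ → CoveredWithout (a ∷ π) x γ}
      (coveredWithout? (a ∷ π)) (coveredWithout-mono (a ∷ π)) (allFin n)
      λ V′ W′ complete _ disjoint′ → fibre V′ W′ (λ x → complete (∈-allFin x)) disjoint′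
    where
    a∉π : a ∉ π
    a∉π a∈π = π⊈V a∈π a⊆V

    fibre : ∀ V′ W′ → (∀ x → x ∈ V′ ⊎ x ∈ W′) → (∀ {x} → x ∈ V′ → x ∉ W′) →
      Removable (SplitCovers π V W a V′ W′)
    fibre V′ W′ total′ disjoint′ with any? (λ x → (x ∈ᵛ? a) ×-dec ¬? (x ∈ᶠ? V′))
    ... | no none = ApexCone.removable π V W a a-stable a∉π V′ W′
      λ {x} x∈a → decidable-stable (x ∈ᶠ? V′) λ x∉V′ → none (x , x∈a , x∉V′)
    ... | yes (x , x∈a , x∉V′)
      -- In a nonempty fibre `V′` lies in `V`, and the points of `V` missing from `V′` are covered
      -- by `a` alone.
      with All.all? (_∈ᶠ? V) V′ | All.all? (λ y → ¬? (y ∈ᶠ? V′) →-dec (y ∈ᵛ? a)) V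
    ...   | no V′⊈V | _ = removable-empty λ ((_ , _ , uncovered) , covered′ , _) →
      V′⊈V (All.map (λ {y} c → covered-V uncovered c (total y)) covered′)
      where
      covered-V : ∀ {y γ} → All (λ x → ¬ CoveredWithout π x γ) W → CoveredWithout (a ∷ π) y γ →
        y ∈ V ⊎ y ∈ W → y ∈ V
      covered-V uncovered c (inj₁ y∈V) = y∈V
      covered-V uncovered c (inj₂ y∈W) = ⊥-elim (All.lookup uncovered y∈W (coveredWithout-tail c))
    ...   | yes _ | no V⊈ = removable-empty λ ((_ , covered , _) , _ , uncovered′) →
      V⊈ (All.map (λ {y} c y∉V′ → covered-a uncovered′ y∉V′ c (total′ y)) covered)
      where
      covered-a : ∀ {y γ} → All (λ x → ¬ CoveredWithout (a ∷ π) x γ) W′ → y ∉ V′ → CoveredWithout π y γ →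
        y ∈ V′ ⊎ y ∈ W′ → y ∈ᵛ a
      covered-a uncovered′ y∉V′ c (inj₁ y∈V′) = ⊥-elim (y∉V′ y∈V′)
      covered-a uncovered′ y∉V′ c (inj₂ y∈W′) with coveredWithout-cases c
      ... | inj₁ c′ = ⊥-elim (All.lookup uncovered′ y∈W′ c′)
      ... | inj₂ (_ , y∈a) = y∈a
    ...   | yes V′⊆V | yes V⊆ =
      removable-resp-≅ (λ γ → mk⇔ forced unforced)
        (stableCovers-removable (rest V′ (All.lookup V′⊆V) (λ y∈V → All.lookup V⊆ y∈V) (x , x∈a , x∉V′))
          (a ∷ π) W′ total′ disjoint′ π′⊈V′)
      where
      π′⊈V′ : ∀ {p} → p ∈ a ∷ π → ¬ p ⊆ᵛ V′
      π′⊈V′ (here refl) a⊆V′ = x∉V′ (a⊆V′ x∈a)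
      π′⊈V′ (there p∈π) p⊆V′ = π⊈V p∈π λ y∈p → All.lookup V′⊆V (p⊆V′ y∈p)
      -- The point `x` must be covered, and every other triple outside `π` misses it.
      a-forced : ∀ {γ} → All (λ x → CoveredWithout π x γ) V → All (λ x → ¬ CoveredWithout (a ∷ π) x γ) W′ → a ∈ γ
      a-forced covered uncovered′ with coveredWithout-cases {a} (All.lookup covered (a⊆V x∈a)) | total′ x
      ... | inj₂ (a∈γ , _) | _ = a∈γ
      ... | inj₁ c | inj₁ x∈V′ = ⊥-elim (x∉V′ x∈V′)
      ... | inj₁ c | inj₂ x∈W′ = ⊥-elim (All.lookup uncovered′ x∈W′ c)
      forced : ∀ {γ} → SplitCovers π V W a V′ W′ γ → StableCovers (a ∷ π) V′ W′ γ
      forced (((π⊆γ , stable) , covered , _) , covered′ , uncovered′) =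
        (a-forced covered uncovered′ ∷ π⊆γ , stable) , covered′ , uncovered′
      unforced : ∀ {γ} → StableCovers (a ∷ π) V′ W′ γ → SplitCovers π V W a V′ W′ γ
      unforced {γ} ((a∈γ ∷ π⊆γ , stable) , covered′ , uncovered′) =
        ((π⊆γ , stable) , All.tabulate in-V , All.tabulate out-W) , covered′ , uncovered′
        where
        in-V : ∀ {y} → y ∈ V → CoveredWithout π y γ
        in-V {y} y∈V with y ∈ᶠ? V′
        ... | yes y∈V′ = coveredWithout-tail (All.lookup covered′ y∈V′)
        ... | no y∉V′ = coveredWithout-intro a∈γ a∉π (All.lookup V⊆ y∈V y∉V′)
        out-W : ∀ {y} → y ∈ W → ¬ CoveredWithout π y γ
        out-W {y} y∈W c with coveredWithout-cases {a} c | total′ y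
        ... | inj₂ (_ , y∈a) | _ = disjoint (a⊆V y∈a) y∈W
        ... | inj₁ c′ | inj₁ y∈V′ = disjoint (All.lookup V′⊆V y∈V′) y∈W
        ... | inj₁ c′ | inj₂ y∈W′ = All.lookup uncovered′ y∈W′ c′

  -- Certificates for unions of at most two arcs

  module Arcs (b : Fin n) where

    InArcs : ℕ → ℕ → ℕ → ℕ → ℕ → Set
    InArcs p q r s e = (p ≤ e × e < q) ⊎ (r ≤ e × e < s)

    TwoArcs : List (Fin n) → ℕ → ℕ → ℕ → ℕ → Set
    TwoArcs V p q r s = ∀ {e} → e < n → (at b e ∈ V → InArcs p q r s e) × (InArcs p q r s e → at b e ∈ V)

    Arc : List (Fin n) → ℕ → ℕ → Set
    Arc V p q = ∀ {e} → e < n → (at b e ∈ V → p ≤ e × e < q) × (p ≤ e × e < q → at b e ∈ V)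

    -- The points lost on passing to `V′` are end points of arcs, so each end moves by at most one.
    -- The last component recovers membership of an end point that was kept.
    trim-front : ∀ V p → ∃ λ p′ → p ≤ p′ × p′ ≤ suc p ×
      (∀ {e} → p ≤ e → at b e ∈ V → p′ ≤ e) × (p′ ≤ p → at b p ∈ V)
    trim-front V p with at b p ∈ᶠ? V
    ... | yes p∈ = p , ≤-refl , n≤1+n p , (λ p≤e _ → p≤e) , λ _ → p∈
    ... | no p∉ = suc p , n≤1+n p , ≤-refl
        , (λ p≤e e∈ → ≤∧≢⇒< p≤e λ { refl → p∉ e∈ }) , λ p<p → ⊥-elim (<-irrefl refl p<p)

    trim-back : ∀ V s → ∃ λ s′ → s ≤ s′ × s′ ≤ suc s ×
      (∀ {e} → e < suc s → at b e ∈ V → e < s′) × (s < s′ → at b s ∈ V)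
    trim-back V s with at b s ∈ᶠ? V
    ... | yes s∈ = suc s , n≤1+n s , ≤-refl , (λ e< _ → e<) , λ _ → s∈
    ... | no s∉ = s , ≤-refl , n≤1+n s
        , (λ { (s≤s e≤s) e∈ → ≤∧≢⇒< e≤s λ { refl → s∉ e∈ } }) , λ s<s → ⊥-elim (<-irrefl refl s<s)

    -- The arcs are half-open, and `N` bounds their total length, written additively to avoid
    -- subtraction. The bound `s < n` leaves position `n - 1` free, so no arc wraps around.
    ArcsReducible : ℕ → Set
    ArcsReducible N = ∀ {V} p q r s → p ≤ q → q ≤ r → r ≤ s → s < n → p < q ⊎ r < s →
      q + s ≤ N + (p + r) → TwoArcs V p q r s → Reducible V

    -- Here `A` stands for the sum of the upper ends and `P` for that of the lower ends: a strictly
    -- shorter total length frees one unit of the bound.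
    decrease : ∀ {N A A′ P P′} → A′ + P < A + P′ → A ≤ suc N + P → A′ ≤ N + P′
    decrease {N} {A} {A′} {P} {P′} lt le = ≤-pred (+-cancelʳ-< P A′ (suc N + P′) (begin-strict
      A′ + P            <⟨ lt ⟩
      A + P′            ≤⟨ +-monoˡ-≤ P′ le ⟩
      suc N + P + P′    ≡⟨ +-assoc (suc N) P P′ ⟩
      suc N + (P + P′)  ≡⟨ cong (suc N +_) (+-comm P P′) ⟩
      suc N + (P′ + P)  ≡⟨ sym (+-assoc (suc N) P′ P) ⟩
      suc N + P′ + P    ∎))
      where open ≤-Reasoning

    -- The apex consists of both end points of the second arc and the first point of the other.
    -- Touching arcs, `q ≡ r`, are allowed, so that a single arc can be treated as two.
    reduce-second : ∀ {N} → ArcsReducible N → ∀ {V} p q r s → p < q → q ≤ r → 2 + p ≤ r → 3 + r ≤ s → s < n →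
      q + s ≤ suc N + (p + r) → TwoArcs V p q r s → Reducible V
    reduce-second {N} ih {V} p q r (suc s) p<q q≤r p+2≤r (s≤s r+2≤s) s+1<n bound arcs =
      reduce T.vertex (proj₂ triple′) covered next-arcs
      where
      s<n : s < n
      s<n = <-trans (n<1+n s) s+1<n
      r<s : r < s
      r<s = <-trans (n<1+n r) r+2≤s
      r<n : r < n
      r<n = <-trans r<s s<n
      p<n : p < n
      p<n = ≤-<-trans (≤-trans (<⇒≤ p<q) q≤r) r<n
      triple′ = stableTriple b {p} {r} {s} p+2≤r r+2≤s (≤-trans s+1<n (m≤n+m n p))
      module T = Triple (proj₁ triple′)
      covered : T.vertex ⊆ᵛ V
      covered x∈ with T.only x∈
      ... | inj₁ refl = proj₂ (arcs p<n) (inj₁ (≤-refl , p<q))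
      ... | inj₂ (inj₁ refl) = proj₂ (arcs r<n) (inj₂ (≤-refl , <-trans r<s (n<1+n s)))
      ... | inj₂ (inj₂ refl) = proj₂ (arcs s<n) (inj₂ (<⇒≤ r<s , n<1+n s))
      next-arcs : ∀ V′ → V′ ⊆ V → (∀ {x} → x ∈ V → x ∉ V′ → x ∈ᵛ T.vertex) →
        (∃ λ x → x ∈ᵛ T.vertex × x ∉ V′) → Reducible V′
      next-arcs V′ V′⊆V V⊆ (x , x∈ , x∉V′)
        with trim-front V′ p | trim-front V′ r | trim-back V′ s
      ... | p′ , p≤p′ , p′≤ , front-p , keep-p | r′ , r≤r′ , r′≤ , front-r , keep-r | s′ , s≤s′ , s′≤ , back-s , keep-s =
        -- The first arc may vanish, but an interior point of the second one survives.
        ih p′ q r′ s′ (≤-trans p′≤ p<q) (≤-trans q≤r r≤r′) (<⇒≤ r′<s′) (≤-<-trans s′≤ s+1<n) (inj₂ r′<s′)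
          (decrease {N} {A = q + suc s} shrinks bound) λ e<n → into e<n , out-of e<n
        where
        r′<s′ : r′ < s′
        r′<s′ = ≤-trans (s≤s r′≤) (≤-trans r+2≤s s≤s′)
        shrinks : q + s′ + (p + r) < q + suc s + (p′ + r′)
        shrinks with T.only x∈
        ... | inj₁ refl = +-mono-≤-< (+-monoʳ-≤ q s′≤) (+-mono-<-≤ (≰⇒> (x∉V′ ∘ keep-p)) r≤r′)
        ... | inj₂ (inj₁ refl) = +-mono-≤-< (+-monoʳ-≤ q s′≤) (+-mono-≤-< p≤p′ (≰⇒> (x∉V′ ∘ keep-r)))
        ... | inj₂ (inj₂ refl) = +-mono-<-≤ (+-monoʳ-< q (s≤s (≮⇒≥ (x∉V′ ∘ keep-s)))) (+-mono-≤ p≤p′ r≤r′)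
        into : ∀ {e} → e < n → at b e ∈ V′ → InArcs p′ q r′ s′ e
        into e<n e∈ with proj₁ (arcs e<n) (V′⊆V e∈)
        ... | inj₁ (p≤e , e<q) = inj₁ (front-p p≤e e∈ , e<q)
        ... | inj₂ (r≤e , e<s) = inj₂ (front-r r≤e e∈ , back-s e<s e∈)
        in-V : ∀ {e} → InArcs p′ q r′ s′ e → InArcs p q r (suc s) e
        in-V (inj₁ (p′≤e , e<q)) = inj₁ (≤-trans p≤p′ p′≤e , e<q)
        in-V (inj₂ (r′≤e , e<s′)) = inj₂ (≤-trans r≤r′ r′≤e , ≤-trans e<s′ s′≤)
        position : ∀ {e} → e < n → at b e ∈ᵛ T.vertex → e ≡ p ⊎ e ≡ r ⊎ e ≡ s
        position e<n e∈ with T.only e∈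
        ... | inj₁ eq = inj₁ (at-injective-< b e<n p<n eq)
        ... | inj₂ (inj₁ eq) = inj₂ (inj₁ (at-injective-< b e<n r<n eq))
        ... | inj₂ (inj₂ eq) = inj₂ (inj₂ (at-injective-< b e<n s<n eq))
        out-of : ∀ {e} → e < n → InArcs p′ q r′ s′ e → at b e ∈ V′
        out-of {e} e<n e∈ with at b e ∈ᶠ? V′
        ... | yes e∈V′ = e∈V′
        ... | no e∉V′ with position e<n (V⊆ (proj₂ (arcs e<n) (in-V e∈)) e∉V′) | e∈
        ...   | inj₁ refl | inj₁ (p′≤p , _) = keep-p p′≤p
        ...   | inj₁ refl | inj₂ (r′≤p , _) = ⊥-elim (<⇒≱ p<q (≤-trans q≤r (≤-trans r≤r′ r′≤p)))
        ...   | inj₂ (inj₁ refl) | inj₁ (_ , r<q) = ⊥-elim (<⇒≱ r<q q≤r)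
        ...   | inj₂ (inj₁ refl) | inj₂ (r′≤r , _) = keep-r r′≤r
        ...   | inj₂ (inj₂ refl) | inj₁ (_ , s<q) = ⊥-elim (<⇒≱ s<q (≤-trans q≤r (<⇒≤ r<s)))
        ...   | inj₂ (inj₂ refl) | inj₂ (_ , s<s′) = keep-s s<s′

    -- The apex consists of both end points of the first arc and the first point of the second; the
    -- gap `q < r` keeps the latter away from the end of the first arc.
    reduce-first : ∀ {N} → ArcsReducible N → ∀ {V} p q r s → 3 + p ≤ q → q < r → r < s → s < n →
      q + s ≤ suc N + (p + r) → TwoArcs V p q r s → Reducible V
    reduce-first {N} ih {V} p (suc q) r s (s≤s p+2≤q) q+1<r r<s s<n bound arcs =
      reduce T.vertex (proj₂ triple′) covered next-arcs
      where
      q<r : q < r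
      q<r = <-trans (n<1+n q) q+1<r
      p<q : p < q
      p<q = <-trans (n<1+n p) p+2≤q
      r<n : r < n
      r<n = <-trans r<s s<n
      q<n : q < n
      q<n = <-trans q<r r<n
      p<n : p < n
      p<n = <-trans p<q q<n
      triple′ = stableTriple b {p} {q} {r} p+2≤q q+1<r (≤-trans (s≤s r<s) (≤-trans s<n (m≤n+m n p)))
      module T = Triple (proj₁ triple′)
      covered : T.vertex ⊆ᵛ V
      covered x∈ with T.only x∈
      ... | inj₁ refl = proj₂ (arcs p<n) (inj₁ (≤-refl , m<n⇒m<1+n p<q))
      ... | inj₂ (inj₁ refl) = proj₂ (arcs q<n) (inj₁ (<⇒≤ p<q , n<1+n q))
      ... | inj₂ (inj₂ refl) = proj₂ (arcs r<n) (inj₂ (≤-refl , r<s))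
      next-arcs : ∀ V′ → V′ ⊆ V → (∀ {x} → x ∈ V → x ∉ V′ → x ∈ᵛ T.vertex) →
        (∃ λ x → x ∈ᵛ T.vertex × x ∉ V′) → Reducible V′
      next-arcs V′ V′⊆V V⊆ (x , x∈ , x∉V′)
        with trim-front V′ p | trim-back V′ q | trim-front V′ r
      ... | p′ , p≤p′ , p′≤ , front-p , keep-p | q′ , q≤q′ , q′≤ , back-q , keep-q | r′ , r≤r′ , r′≤ , front-r , keep-r =
        ih p′ q′ r′ s (<⇒≤ p′<q′) (≤-trans q′≤ (≤-trans (<⇒≤ q+1<r) r≤r′)) (≤-trans r′≤ r<s) s<n (inj₁ p′<q′)
          (decrease {N} {A = suc q + s} shrinks bound) λ e<n → into e<n , out-of e<n
        where
        p′<q′ : p′ < q′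
        p′<q′ = ≤-trans (s≤s p′≤) (≤-trans p+2≤q q≤q′)
        shrinks : q′ + s + (p + r) < suc q + s + (p′ + r′)
        shrinks with T.only x∈
        ... | inj₁ refl = +-mono-≤-< (+-monoˡ-≤ s q′≤) (+-mono-<-≤ (≰⇒> (x∉V′ ∘ keep-p)) r≤r′)
        ... | inj₂ (inj₁ refl) = +-mono-<-≤ (+-monoˡ-< s (s≤s (≮⇒≥ (x∉V′ ∘ keep-q)))) (+-mono-≤ p≤p′ r≤r′)
        ... | inj₂ (inj₂ refl) = +-mono-≤-< (+-monoˡ-≤ s q′≤) (+-mono-≤-< p≤p′ (≰⇒> (x∉V′ ∘ keep-r)))
        into : ∀ {e} → e < n → at b e ∈ V′ → InArcs p′ q′ r′ s e
        into e<n e∈ with proj₁ (arcs e<n) (V′⊆V e∈)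
        ... | inj₁ (p≤e , e<q) = inj₁ (front-p p≤e e∈ , back-q e<q e∈)
        ... | inj₂ (r≤e , e<s) = inj₂ (front-r r≤e e∈ , e<s)
        in-V : ∀ {e} → InArcs p′ q′ r′ s e → InArcs p (suc q) r s e
        in-V (inj₁ (p′≤e , e<q′)) = inj₁ (≤-trans p≤p′ p′≤e , ≤-trans e<q′ q′≤)
        in-V (inj₂ (r′≤e , e<s)) = inj₂ (≤-trans r≤r′ r′≤e , e<s)
        position : ∀ {e} → e < n → at b e ∈ᵛ T.vertex → e ≡ p ⊎ e ≡ q ⊎ e ≡ r
        position e<n e∈ with T.only e∈
        ... | inj₁ eq = inj₁ (at-injective-< b e<n p<n eq)
        ... | inj₂ (inj₁ eq) = inj₂ (inj₁ (at-injective-< b e<n q<n eq))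
        ... | inj₂ (inj₂ eq) = inj₂ (inj₂ (at-injective-< b e<n r<n eq))
        out-of : ∀ {e} → e < n → InArcs p′ q′ r′ s e → at b e ∈ V′
        out-of {e} e<n e∈ with at b e ∈ᶠ? V′
        ... | yes e∈V′ = e∈V′
        ... | no e∉V′ with position e<n (V⊆ (proj₂ (arcs e<n) (in-V e∈)) e∉V′) | e∈
        ...   | inj₁ refl | inj₁ (p′≤p , _) = keep-p p′≤p
        ...   | inj₁ refl | inj₂ (r′≤p , _) = ⊥-elim (<⇒≱ (<-trans p<q q<r) (≤-trans r≤r′ r′≤p))
        ...   | inj₂ (inj₁ refl) | inj₁ (_ , q<q′) = keep-q q<q′
        ...   | inj₂ (inj₁ refl) | inj₂ (r′≤q , _) = ⊥-elim (<⇒≱ q<r (≤-trans r≤r′ r′≤q))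
        ...   | inj₂ (inj₂ refl) | inj₁ (_ , r<q′) = ⊥-elim (<⇒≱ q+1<r (≤-trans (<⇒≤ r<q′) q′≤))
        ...   | inj₂ (inj₂ refl) | inj₂ (r′≤r , _) = keep-r r′≤r

    -- An arc with at least five points is cut after its second point, so that the apex becomes its
    -- two end points and its third point. In a shorter arc no stable triple fits.
    reduce-single : ∀ {N} → ArcsReducible N → ∀ {V} p q → p < q → q < n → q ≤ suc N + p → Arc V p q → Reducible V
    reduce-single {N} ih {V} p q p<q q<n bound arc with 5 + p ≤? q
    ... | yes 5+p≤q = reduce-second {N} ih p (2 + p) (2 + p) q (m≤n⇒m≤1+n ≤-refl) ≤-refl ≤-refl 5+p≤q q<n bound′
            λ e<n → split ∘ proj₁ (arc e<n) , proj₂ (arc e<n) ∘ join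
      where
      bound′ : 2 + p + q ≤ suc N + (p + (2 + p))
      bound′ = begin
        2 + p + q               ≤⟨ +-monoʳ-≤ (2 + p) bound ⟩
        2 + p + (suc N + p)     ≡⟨ +-comm (2 + p) (suc N + p) ⟩
        suc N + p + (2 + p)     ≡⟨ +-assoc (suc N) p (2 + p) ⟩
        suc N + (p + (2 + p))   ∎
        where open ≤-Reasoning
      split : ∀ {e} → p ≤ e × e < q → InArcs p (2 + p) (2 + p) q e
      split {e} (p≤e , e<q) with e <? 2 + p
      ... | yes e<2+p = inj₁ (p≤e , e<2+p)
      ... | no e≮2+p = inj₂ (≮⇒≥ e≮2+p , e<q)
      join : ∀ {e} → InArcs p (2 + p) (2 + p) q e → p ≤ e × e < q
      join (inj₁ (p≤e , e<2+p)) = p≤e , ≤-trans e<2+p (≤-trans (m≤n+m (2 + p) 3) 5+p≤q)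
      join (inj₂ (2+p≤e , e<q)) = ≤-trans (m≤n+m p 2) 2+p≤e , e<q
    ... | no 5+p≰q = uncoverable (proj₂ (arc (<-trans p<q q<n)) (≤-refl , p<q)) none
      where
      none : ∀ v → Stable v → ¬ v ⊆ᵛ V
      none v stable v⊆V with sort b v stable
      ... | sorted e+2≤f f+2≤g g<n e∈ f∈ g∈
        with proj₁ (arc (<-trans (≤-trans (s≤s (n≤1+n _)) e+2≤f) (<-trans (≤-trans (s≤s (n≤1+n _)) f+2≤g) g<n))) (v⊆V e∈)
           | proj₁ (arc g<n) (v⊆V g∈)
      -- Two gaps of at least 2 make the triple span five positions.
      ... | p≤e , _ | _ , g<q = 5+p≰q (≤-trans (s≤s (≤-trans (s≤s (s≤s (≤-trans (s≤s (s≤s p≤e)) e+2≤f))) f+2≤g)) g<q)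

    -- With at most two points per arc, a stable triple has at most one point in each. The middle
    -- point always shares its arc with a neighbour in the order.
    short-arcs : ∀ {V} p q r s → p < q → q < r → s < n → q ≤ 2 + p → s ≤ 2 + r → TwoArcs V p q r s → r ≤ s → Reducible V
    short-arcs {V} p q r s p<q q<r s<n q≤2+p s≤2+r arcs r≤s =
      uncoverable (proj₂ (arcs p<n) (inj₁ (≤-refl , p<q))) none
      where
      p<n : p < n
      p<n = <-trans p<q (<-trans q<r (≤-<-trans r≤s s<n))
      none : ∀ v → Stable v → ¬ v ⊆ᵛ V
      none v stable v⊆V with sort b v stable
      ... | sorted {e} {f} {g} e+2≤f f+2≤g g<n e∈ f∈ g∈
        with proj₁ (arcs (<-trans e<f (<-trans f<g g<n))) (v⊆V e∈)
           | proj₁ (arcs (<-trans f<g g<n)) (v⊆V f∈) | proj₁ (arcs g<n) (v⊆V g∈)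
        where
        e<f : e < f
        e<f = ≤-trans (s≤s (n≤1+n _)) e+2≤f
        f<g : f < g
        f<g = ≤-trans (s≤s (n≤1+n _)) f+2≤g
      ... | inj₁ (p≤e , _) | inj₁ (_ , f<q) | _ = <⇒≱ f<q (≤-trans q≤2+p (≤-trans (s≤s (s≤s p≤e)) e+2≤f))
      ... | inj₂ (r≤e , _) | inj₁ (_ , f<q) | _ =
        <⇒≱ f<q (≤-trans (<⇒≤ q<r) (≤-trans r≤e (≤-trans (m≤n+m e 2) e+2≤f)))
      ... | _ | inj₂ (r≤f , _) | inj₂ (_ , g<s) = <⇒≱ g<s (≤-trans s≤2+r (≤-trans (s≤s (s≤s r≤f)) f+2≤g))
      ... | _ | inj₂ (r≤f , _) | inj₁ (_ , g<q) =
        <⇒≱ g<q (≤-trans (<⇒≤ q<r) (≤-trans r≤f (≤-trans (m≤n+m f 2) f+2≤g)))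

    -- An empty arc, or two arcs that touch, leave a single arc. Two separated arcs are reduced at
    -- one that has three or more points, and if neither has, no stable triple fits.
    arcs-reducible : ∀ N → ArcsReducible N
    arcs-reducible zero p q r s p≤q q≤r r≤s s<n nonempty bound arcs = ⊥-elim (<⇒≱ (grows nonempty) bound)
      where
      grows : p < q ⊎ r < s → p + r < q + s
      grows (inj₁ p<q) = +-mono-<-≤ p<q r≤s
      grows (inj₂ r<s) = +-mono-≤-< p≤q r<s
    arcs-reducible (suc N) {V} p q r s p≤q q≤r r≤s s<n nonempty bound arcs with m≤n⇒m<n∨m≡n p≤q
    ... | inj₂ refl = reduce-single {N} (arcs-reducible N) r s (r<s nonempty) s<n
        (+-cancelˡ-≤ p _ _ (≤-trans bound (≤-reflexive (trans (sym (+-assoc (suc N) p r))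
          (trans (cong (_+ r) (+-comm (suc N) p)) (+-assoc p (suc N) r))))))
        λ e<n → second ∘ proj₁ (arcs e<n) , proj₂ (arcs e<n) ∘ inj₂
      where
      r<s : p < p ⊎ r < s → r < s
      r<s (inj₁ p<p) = ⊥-elim (<-irrefl refl p<p)
      r<s (inj₂ r<s) = r<s
      second : ∀ {e} → InArcs p p r s e → r ≤ e × e < s
      second (inj₁ (p≤e , e<p)) = ⊥-elim (<⇒≱ e<p p≤e)
      second (inj₂ in-arc) = in-arc
    ... | inj₁ p<q with m≤n⇒m<n∨m≡n r≤s
    ...   | inj₂ refl = reduce-single {N} (arcs-reducible N) p q p<q (≤-<-trans q≤r s<n)
        (+-cancelʳ-≤ r _ _ (≤-trans bound (≤-reflexive (sym (+-assoc (suc N) p r)))))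
        λ e<n → first ∘ proj₁ (arcs e<n) , proj₂ (arcs e<n) ∘ inj₁
      where
      first : ∀ {e} → InArcs p q r r e → p ≤ e × e < q
      first (inj₁ in-arc) = in-arc
      first (inj₂ (r≤e , e<r)) = ⊥-elim (<⇒≱ e<r r≤e)
    ...   | inj₁ r<s with m≤n⇒m<n∨m≡n q≤r
    ...     | inj₂ refl = reduce-single {N} (arcs-reducible N) p s (<-trans p<q r<s) s<n
        (+-cancelˡ-≤ q _ _ (≤-trans bound (≤-reflexive (trans (sym (+-assoc (suc N) p q)) (+-comm (suc N + p) q)))))
        λ e<n → join ∘ proj₁ (arcs e<n) , proj₂ (arcs e<n) ∘ split
      where
      join : ∀ {e} → InArcs p q q s e → p ≤ e × e < s
      join (inj₁ (p≤e , e<q)) = p≤e , <-trans e<q r<s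
      join (inj₂ (q≤e , e<s)) = ≤-trans p≤q q≤e , e<s
      split : ∀ {e} → p ≤ e × e < s → InArcs p q q s e
      split {e} (p≤e , e<s) with e <? q
      ... | yes e<q = inj₁ (p≤e , e<q)
      ... | no e≮q = inj₂ (≮⇒≥ e≮q , e<s)
    ...     | inj₁ q<r with 3 + r ≤? s | 3 + p ≤? q
    ...       | yes 3+r≤s | _ = reduce-second {N} (arcs-reducible N) p q r s p<q q≤r (≤-trans (s≤s p<q) q<r) 3+r≤s s<n bound arcs
    ...       | no _ | yes 3+p≤q = reduce-first {N} (arcs-reducible N) p q r s 3+p≤q q<r r<s s<n bound arcs
    ...       | no 3+r≰s | no 3+p≰q = short-arcs p q r s p<q q<r s<n (≤-pred (≰⇒> 3+p≰q)) (≤-pred (≰⇒> 3+r≰s)) arcs r≤s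

  -- Decomposing the covered set into arcs

  scan : {P : ℕ → Set} → Decidable P → ∀ d i →
    ∃ λ q → i ≤ q × q ≤ d + i × (∀ {e} → i ≤ e → e < q → P e) × (q ≡ d + i ⊎ ¬ P q)
  scan P? zero i = i , ≤-refl , ≤-refl , (λ i≤e e<i → ⊥-elim (<⇒≱ e<i i≤e)) , inj₁ refl
  scan {P} P? (suc d) i with P? i
  ... | no ¬Pi = i , ≤-refl , m≤n+m i (suc d) , (λ i≤e e<i → ⊥-elim (<⇒≱ e<i i≤e)) , inj₂ ¬Pi
  ... | yes Pi with scan P? d (suc i)
  ...   | q , i<q , q≤ , run , end = q , <⇒≤ i<q , ≤-trans q≤ (≤-reflexive (+-suc d i)) , run′ , end′ end
    where
    run′ : ∀ {e} → i ≤ e → e < q → P e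
    run′ i≤e e<q with m≤n⇒m<n∨m≡n i≤e
    ... | inj₁ i<e = run i<e e<q
    ... | inj₂ refl = Pi
    end′ : q ≡ d + suc i ⊎ ¬ P q → q ≡ suc d + i ⊎ ¬ P q
    end′ (inj₁ eq) = inj₁ (trans eq (+-suc d i))
    end′ (inj₂ ¬Pq) = inj₂ ¬Pq

  -- A walk that starts outside `V` and ends inside must enter `V` at some step.
  boundary : ∀ V c e → at c 0 ∉ V → at c e ∈ V → ∃ λ t → t ∉ V × succ t ∈ V
  boundary V c zero c∉V c∈V = ⊥-elim (c∉V c∈V)
  boundary V c (suc e) c∉V e+1∈V with at c e ∈ᶠ? V
  ... | yes e∈V = boundary V c e c∉V e∈V
  ... | no e∉V = at c e , e∉V , e+1∈V

  -- Two maximal runs of V are found by scanning; an element of V after them would yield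
  -- three gaps of V, and one point from each gap makes a stable triple.
  two-arcs : ∀ V b → at b 0 ∈ V → at b (5 + k) ∉ V → (∀ w → Stable w → ∃ λ x → x ∈ᵛ w × x ∈ V) → Reducible V
  two-arcs V b 0∈V last∉V meets
    with scan (λ e → at b e ∈ᶠ? V) (5 + k) 0
  ... | q , _ , q≤ , run₁ , end₁
    with scan (λ e → ¬? (at b e ∈ᶠ? V)) (5 + k ∸ q) q
  ... | r , q≤r , r≤ , run₂ , end₂
    with scan (λ e → at b e ∈ᶠ? V) (5 + k ∸ r) r
  ... | s , r≤s , s≤ , run₃ , end₃ =
    -- The first arc starts at 0, so `q + s` certainly bounds the total length.
    Arcs.arcs-reducible b (q + s) 0 q r s z≤n q≤r r≤s s<n (inj₁ 0<q) (m≤m+n (q + s) r) arcs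
    where
    q≤5+k : q ≤ 5 + k
    q≤5+k = ≤-trans q≤ (≤-reflexive (+-identityʳ (5 + k)))
    r≤5+k : r ≤ 5 + k
    r≤5+k = ≤-trans r≤ (≤-reflexive (m∸n+n≡m q≤5+k))
    s≤5+k : s ≤ 5 + k
    s≤5+k = ≤-trans s≤ (≤-reflexive (m∸n+n≡m r≤5+k))
    s<n : s < n
    s<n = s≤s s≤5+k
    -- A run of members stopped only by the cut-off ends at position `n - 1`, which is outside `V`
    -- by assumption.
    stop : ∀ {q m} → m ≡ 5 + k → q ≡ m ⊎ at b q ∉ V → at b q ∉ V
    stop refl (inj₁ refl) = last∉V
    stop _ (inj₂ q∉V) = q∉V
    q∉V : at b q ∉ V
    q∉V = stop (+-identityʳ (5 + k)) end₁
    s∉V : at b s ∉ V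
    s∉V = stop (m∸n+n≡m r≤5+k) end₃
    0<q : 0 < q
    0<q = n≢0⇒n>0 λ { refl → q∉V 0∈V }
    r∈V : r < 5 + k → at b r ∈ V
    r∈V r<5+k = case end₂ of λ
      { (inj₁ r≡) → ⊥-elim (<-irrefl (trans r≡ (m∸n+n≡m q≤5+k)) r<5+k)
      ; (inj₂ ¬r∉V) → decidable-stable (at b r ∈ᶠ? V) ¬r∉V }
    tail-∉ : ∀ {e} → s ≤ e → e < n → at b e ∉ V
    tail-∉ {e} s≤e e<n e∈V =
      let x , x∈ , x∈V = meets T.vertex (proj₂ triple′) in misses x∈V (T.only x∈)
      where
      s<e : s < e
      s<e = ≤∧≢⇒< s≤e λ { refl → s∉V e∈V }
      e<5+k : e < 5 + k
      e<5+k = ≤∧≢⇒< (≤-pred e<n) λ { refl → last∉V e∈V }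
      r∈ : at b r ∈ V
      r∈ = r∈V (≤-<-trans r≤s (<-trans s<e e<5+k))
      q<r : q < r
      q<r = ≤∧≢⇒< q≤r λ { refl → q∉V r∈ }
      r<s : r < s
      r<s = ≤∧≢⇒< r≤s λ { refl → s∉V r∈ }
      -- One point from each gap: `r` separates `q` from `s`, `e` separates `s` from `n - 1`, and
      -- the base point separates `n - 1` from `q`.
      triple′ = stableTriple b {q} {s} {5 + k} (≤-trans (s≤s q<r) r<s) (≤-trans (s≤s s<e) e<5+k) (+-monoˡ-≤ n 0<q)
      module T = Triple (proj₁ triple′)
      misses : ∀ {x} → x ∈ V → ¬ (x ≡ at b q ⊎ x ≡ at b s ⊎ x ≡ at b (5 + k))
      misses x∈V (inj₁ refl) = q∉V x∈V
      misses x∈V (inj₂ (inj₁ refl)) = s∉V x∈V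
      misses x∈V (inj₂ (inj₂ refl)) = last∉V x∈V
    arcs : Arcs.TwoArcs b V 0 q r s
    arcs {e} e<n = into , λ { (inj₁ (0≤e , e<q)) → run₁ 0≤e e<q ; (inj₂ (r≤e , e<s)) → run₃ r≤e e<s }
      where
      into : at b e ∈ V → Arcs.InArcs b 0 q r s e
      into e∈V with e <? q | e <? r | e <? s
      ... | yes e<q | _ | _ = inj₁ (z≤n , e<q)
      ... | no e≮q | yes e<r | _ = ⊥-elim (run₂ (≮⇒≥ e≮q) e<r e∈V)
      ... | no _ | no e≮r | yes e<s = inj₂ (≮⇒≥ e≮r , e<s)
      ... | no _ | no _ | no e≮s = ⊥-elim (tail-∉ (≮⇒≥ e≮s) e<n e∈V)

  -- The base point is rotated to the start of a run of `V`, so that the last position lies outside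
  -- `V`.
  reducible : ∀ {V x c} → x ∈ V → c ∉ V → (∀ w → Stable w → ∃ λ x → x ∈ᵛ w × x ∈ V) → Reducible V
  reducible {V} {x} {c} x∈V c∉V meets =
    let e , _ , at≡x = at-surjective c x
        t , t∉V , st∈V = boundary V c e c∉V (subst (_∈ V) (sym at≡x) x∈V)
    in two-arcs V (succ t) st∈V
         (subst (_∉ V) (sym (at-last t)) t∉V) meets
    where
    at-last : ∀ t → at (succ t) (5 + k) ≡ t
    at-last t = succ-injective (at-wrap (succ t))

  -- Removing the stable simplices without a stable common neighbour

  Bounded : Complex (Vertex k)
  Bounded γ = ∃ λ w → All (λ v → Disjoint v w) γ

  DisjointFrom : List (Fin n) → Vertex k → Set
  DisjointFrom V w = All (λ x → ¬ x ∈ᵛ w) V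

  disjointFrom? : ∀ V w → Dec (DisjointFrom V w)
  disjointFrom? V w = All.all? (λ x → ¬? (x ∈ᵛ? w)) V

  -- Whether a common neighbour, stable or not, exists depends only on the union `V` of the simplex.
  -- Each piece of fixed union is therefore empty or consists of all stable covers of `V`.
  stable-removable :
    Removable (λ γ → γ ≢ [] × All Stable γ × Bounded γ × ¬ StablyBounded γ)
  stable-removable =
    removable-fibres (_≟ᶠ_ {n}) {P = λ x γ → CoveredWithout [] x γ}
      (coveredWithout? []) (coveredWithout-mono []) (allFin n)
      λ V W complete _ disjoint → fibre V W (λ x → complete (∈-allFin x)) disjoint
    where
    A : Complex (Vertex k)
    A γ = γ ≢ [] × All Stable γ × Bounded γ × ¬ StablyBounded γ

    Piece : List (Fin n) → List (Fin n) → Complex (Vertex k)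
    Piece V W γ = A γ × All (λ x → CoveredWithout [] x γ) V × All (λ x → ¬ CoveredWithout [] x γ) W

    from-V : ∀ {V γ w} → All (λ x → CoveredWithout [] x γ) V → All (λ v → Disjoint v w) γ → DisjointFrom V w
    from-V {w = w} covered disj = All.map (λ c → covered-∉ w disj (Any.map proj₂ c)) covered

    module _ {V W : List (Fin n)} (total : ∀ x → x ∈ V ⊎ x ∈ W) where

      to-V : ∀ {γ w} → All (λ x → ¬ CoveredWithout [] x γ) W → DisjointFrom V w → All (λ v → Disjoint v w) γ
      to-V {γ} {w} uncovered disj = All.tabulate λ v∈γ i i∈v → absurd v∈γ i∈v (total i)
        where
        absurd : ∀ {v i} → v ∈ γ → i ∈ᵛ v → i ∈ V ⊎ i ∈ W → ¬ i ∈ᵛ w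
        absurd v∈γ i∈v (inj₁ i∈V) = All.lookup disj i∈V
        absurd v∈γ i∈v (inj₂ i∈W) = ⊥-elim (All.lookup uncovered i∈W (coveredWithout-intro v∈γ (λ ()) i∈v))

      nonempty : ∀ {γ} → γ ≢ [] → All (λ x → ¬ CoveredWithout [] x γ) W → V ≢ []
      nonempty {[]} γ≢[] _ = ⊥-elim (γ≢[] refl)
      nonempty {v ∷ γ} _ uncovered refl with another v zero zero
      ... | x , x∈v , _ with total x
      ...   | inj₂ x∈W = All.lookup uncovered x∈W (here ((λ ()) , x∈v))

    fibre : ∀ V W → (∀ x → x ∈ V ⊎ x ∈ W) → (∀ {x} → x ∈ V → x ∉ W) → Removable (Piece V W)
    fibre [] W total _ = removable-empty λ ((γ≢[] , _) , _ , uncovered) → nonempty total γ≢[] uncovered refl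
    fibre V@(x ∷ _) W total disjoint
      with anyVertex? (disjointFrom? V) | anyVertex? (λ w → stable? w ×-dec disjointFrom? V w)
    ... | no unbounded | _ = removable-empty λ ((_ , _ , (w , disj) , _) , covered , _) →
      unbounded (w , from-V {w = w} covered disj)
    ... | yes _ | yes (w , stable , disj) = removable-empty λ ((_ , _ , _ , unbounded) , _ , uncovered) →
      unbounded (w , stable , to-V total {w = w} uncovered disj)
    ... | yes (w , disj) | no ¬stable =
      removable-resp-≅ (λ γ → mk⇔
          (λ ((_ , stable , _) , covered , uncovered) → ([] , stable) , covered , uncovered)
          (λ ((_ , stable) , covered , uncovered) →
            ((λ { refl → absurd (All.lookup covered (here refl)) }) , stable , (w , to-V total {w = w} uncovered disj)
            , λ (w′ , stable′ , disj′) → ¬stable (w′ , stable′ , from-V {w = w′} covered disj′))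
            , covered , uncovered))
        (stableCovers-removable V-reducible [] W total disjoint λ ())
      where
      absurd : ∀ {x} → ¬ CoveredWithout [] x []
      absurd ()
      meets : ∀ w → Stable w → ∃ λ x → x ∈ᵛ w × x ∈ V
      meets w stable with any? (λ x → (x ∈ᵛ? w) ×-dec (x ∈ᶠ? V))
      ... | yes found = found
      ... | no none = ⊥-elim (¬stable (w , stable , All.tabulate λ x∈V x∈w → none (_ , x∈w , x∈V)))
      V-reducible : Reducible V
      V-reducible =
        -- Any point of a common neighbour lies outside `V`.
        let c , c∈w , _ = another w zero zero
        in reducible (here refl) (λ c∈V → All.lookup disj c∈V c∈w) meets

  -- Assembling the collapse

  Target : Complex (Vertex k)
  Target γ = All Stable γ × StablyBounded γ

  noneUnstable⇒allStable : ∀ {γ} → ¬ Any (¬_ ∘ Stable) γ → All (Stable {k}) γ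
  noneUnstable⇒allStable none = All.tabulate λ {v} v∈γ →
    decidable-stable (stable? v) λ unstable → none (lose v∈γ unstable)

  allStable⇒noneUnstable : ∀ {γ} → All (Stable {k}) γ → ¬ Any (¬_ ∘ Stable) γ
  allStable⇒noneUnstable all any = let stable , unstable = All.lookupAny all any in unstable stable

  bounded⇒S : ∀ {γ} → StablyBounded γ → ∃ λ w → All (λ v → S k v w) γ
  bounded⇒S (w , stable , disj) = w , All.map (λ d → d , inj₂ stable) disj

  S⇒bounded : ∀ {γ} → ∃ (λ w → All (λ v → S k v w) γ) → Bounded γ
  S⇒bounded (w , adj) = w , All.map proj₁ adj

  -- Every edge of `S k` at an unstable vertex has a stable other end, here the common neighbour.
  unstable⇒stablyBounded : ∀ {γ} → Any (¬_ ∘ Stable) γ → ∃ (λ w → All (λ v → S k v w) γ) → StablyBounded γ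
  unstable⇒stablyBounded any (w , adj) with All.lookupAny adj any
  ... | (_ , inj₁ stable) , unstable = ⊥-elim (unstable stable)
  ... | (_ , inj₂ stable) , _ = w , stable , All.map proj₁ adj

  -- Containing an unstable vertex is a monotone condition, so those simplices are removed first and
  -- the purely stable ones afterwards.
  difference-removable : Removable (NeighborhoodComplex (S k) ∖ Target)
  difference-removable =
    removable-split (Any.any? (¬? ∘ stable?)) Any-resp-⊆
      (removable-resp-≅
        (λ γ → mk⇔ (λ (((_ , nbr) , _) , any) → any , unstable⇒stablyBounded any nbr)
                   (λ (any , bounded) → (((λ { refl → absurd any }) , bounded⇒S bounded)
                      , λ (stable , _) → allStable⇒noneUnstable stable any) , any))
        unstable-removable)
      (removable-resp-≅
        (λ γ → mk⇔ (λ (((γ≢[] , nbr) , ¬target) , none) →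
                      γ≢[] , noneUnstable⇒allStable none , S⇒bounded nbr , λ bounded → ¬target (noneUnstable⇒allStable none , bounded))
                   (λ (γ≢[] , stable , (w , disj) , ¬bounded) →
                      ((γ≢[] , w , All.zipWith (λ (st , d) → d , inj₁ st) (stable , disj))
                      , λ (_ , bounded) → ¬bounded bounded) , allStable⇒noneUnstable stable))
        stable-removable)
    where
    absurd : ¬ Any (¬_ ∘ Stable {k}) []
    absurd ()

  withStability : ∀ {γ} → All (Stable {k}) γ → List (StableVertex k)
  withStability [] = []
  withStability (_∷_ {v} stable rest) = (v , stable) ∷ withStability rest

  map-withStability : ∀ {γ} (stable : All Stable γ) → map proj₁ (withStability stable) ≡ γ
  map-withStability [] = refl
  map-withStability (_ ∷ rest) = cong (_ ∷_) (map-withStability rest)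

  -- Decidability of `Target` undoes the double complement; what is left is lifted to stable
  -- vertices and back.
  remainder≅SG : (NeighborhoodComplex (S k) ∖ (NeighborhoodComplex (S k) ∖ Target)) ≅ Image proj₁ (NeighborhoodComplex (SG k))
  remainder≅SG γ = mk⇔ to′ from′
    where
    target? : Dec (Target γ)
    target? = All.all? stable? γ ×-dec stablyBounded? γ

    to′ : (NeighborhoodComplex (S k) ∖ (NeighborhoodComplex (S k) ∖ Target)) γ → Image proj₁ (NeighborhoodComplex (SG k)) γ
    to′ (Kγ , ¬diff) with decidable-stable target? (λ ¬target → ¬diff (Kγ , ¬target))
    ... | stable , w , w-stable , disj =
      withStability stable
      , (nonempty stable (proj₁ Kγ) , (w , w-stable) , lift stable disj)
      , (λ {v} → subst (v ∈_) (sym (map-withStability stable)))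
      , (λ {v} → subst (v ∈_) (map-withStability stable))
      where
      nonempty : ∀ {δ} (stable : All Stable δ) → δ ≢ [] → withStability stable ≢ []
      nonempty [] δ≢[] _ = δ≢[] refl
      lift : ∀ {δ} (stable : All Stable δ) → All (λ v → Disjoint v w) δ →
        All (λ v → SG k v (w , w-stable)) (withStability stable)
      lift [] [] = []
      lift (_ ∷ stable) (d ∷ disj) = d ∷ lift stable disj

    from′ : Image proj₁ (NeighborhoodComplex (SG k)) γ → (NeighborhoodComplex (S k) ∖ (NeighborhoodComplex (S k) ∖ Target)) γ
    from′ (σ , (σ≢[] , (w , w-stable) , adj) , γ⊆σ , σ⊆γ) =
      ((λ { refl → nonempty σ≢[] σ⊆γ }) , bounded⇒S bounded) , λ (_ , ¬target) → ¬target (All-resp-⊇ γ⊆σ (stables σ) , bounded)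
      where
      nonempty : ∀ {σ : List (StableVertex k)} → σ ≢ [] → ¬ map proj₁ σ ⊆ []
      nonempty {[]} σ≢[] _ = σ≢[] refl
      nonempty {_ ∷ _} _ σ⊆[] with σ⊆[] (here refl)
      ... | ()
      stables : (σ : List (StableVertex k)) → All Stable (map proj₁ σ)
      stables [] = []
      stables ((_ , stable) ∷ σ) = stable ∷ stables σ
      bounded : StablyBounded γ
      bounded = w , w-stable , All-resp-⊇ γ⊆σ (map⁺ adj)

theorem1p1 : (k : ℕ) →
    Collapses (NeighborhoodComplex (S k))
    (Image proj₁ (NeighborhoodComplex (SG k)))
theorem1p1 k = difference-removable proj₁ upper (done remainder≅SG)
  where
  -- `Target` is closed under passing to subsets, so its complement is an upper set.
  upper : ∀ {γ δ} → γ ⊆ δ → (NeighborhoodComplex (S k) ∖ Target) γ → NeighborhoodComplex (S k) δ →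
    (NeighborhoodComplex (S k) ∖ Target) δ
  upper γ⊆δ (_ , ¬target) Kδ = Kδ , λ (stable , bounded) →
    ¬target (All-resp-⊇ γ⊆δ stable , stablyBounded-anti γ⊆δ bounded)
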